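{- Let $n\ge k>0$ be integers, let $\lambda,\mu$ be binary sequences of length $n$ with exactly $k$ ones, and let $P^{\emptyset,\Omega}_{\lambda\mu}$ be a $\nu$-free puzzle with $\Omega=\Omega_t\cup\Omega_r\cup\Omega_b$. Let $\overline\Omega$ be a separable atomic refinement of $\Omega$, let $I^{\emptyset,\Omega}_{\lambda\mu}\subseteq\mathbb{F}_3[\boldsymbol x]$ be the $\nu$-free puzzle ideal of $P^{\emptyset,\Omega}_{\lambda\mu}$, and let $I^{\emptyset,\Omega}=I^{\emptyset,\Omega}_{\lambda\mu}\cap\mathbb{F}_3[\boldsymbol x_b]$ be its elimination ideal with respect to the variables $\boldsymbol x_b=\{x_{b1},\dots,x_{bn}\}$ of the bottom side. Then: (1) $I^{\emptyset,\Omega}$ is radical. (2) Let $I^{\emptyset,\Omega}=\bigcap_k p_k$ be the prime decomposition of $I^{\emptyset,\Omega}$. Then each $p_k$ is of the form $\langle x_{b1}-\overline\nu_{k1},\dots,x_{bn}-\overline\nu_{kn}\rangle$, where $\overline\nu_{ki}\in\mathbb{F}_2=\{0,1\}$ for $i=1,\dots,n$. (3) Let $\overline\nu_k=(\overline\nu_{k1},\dots,\overline\nu_{kn})\in V(I^{\emptyset,\Omega})$ and let $p_k$ be the prime ideal corresponding to it. Then $I^{\overline\nu_k,\Omega}_{\lambda\mu}=I^{\emptyset,\Omega}_{\lambda\mu}+p_k$, where $I^{\emptyset,\Omega}_{\lambda\mu}+p_k$ is the ideal of $\mathbb{F}_3[\boldsymbol x]$ generated by $I^{\emptyset,\Omega}_{\lambda\mu}$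 and $p_k$, and $I^{\overline\nu_k,\Omega}_{\lambda\mu}$ is the puzzle ideal of $P^{\overline\nu_k,\Omega}_{\lambda\mu}$.
   Context: **Puzzles.** Consider the upward equilateral triangle of side length $n$, subdivided into $n^2$ unit triangles with $N=\frac{3n(n+1)}{2}$ unit intervals as sides. $\bigtriangleup^{\nu}_{\lambda\mu}$ ($\nu\in\mathbb{F}_2^n$) is this triangle with the unit intervals of its left, right and bottom sides carrying the values of $\lambda,\mu,\nu$, each side read from left to right; $\bigtriangleup^\emptyset_{\lambda\mu}$ is the same with no prescribed values on the bottom side. An $\mathbb{F}_q$-valued puzzle piece is a convex polygon whose sides are parallel to sides of the big triangle and of integer length, with an $\mathbb{F}_q$-value on each unit interval of its boundary. A tiling with a set of pieces is a covering by translates of pieces of the set (repetition allowed; no rotation or mirroring) without overlaps or gaps, such that values on common edges of adjacent pieces match and prescribed boundary values match. $\mathbb{F}_2$-values are embedded in $\mathbb{F}_3$ as $0,1$. $\Omega(t)$ denotes the set of pieces appearing in a tiling $t$. The puzzle $P^{\nu,\Omega}_{\lambda\mu}$ (resp. $\nu$-free puzzle $P^{\emptyset,\Omega}_{\lambda\mu}$) consists of $\bigtriangleup^\nu_{\lambda\mu}$ (resp. $\bigtriangleup^\emptyset_{\lambda\mu}$) and a set $\Omega$ of $\mathbb{F}_2$-valued pieces. **Shapes.** $\Omega=\Omega_t\cup\Omega_r\cup\Omega_b$ means: the pieces in $\Omega$ are unit triangles ($\Omega_t$), unit rhombuses ($\Omega_r$), or all of the shape of one fixed bigger convex polygon ($\Omega_b$,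 possibly empty). **Atomic refinement.** An atomic piece is an $\mathbb{F}_3$-valued unit triangle whose three values sum to $0$ in $\mathbb{F}_3$. It is regular if it is not $(0,0,0)$-, $(1,1,1)$- or $(2,2,2)$-valued. $\Omega$ is refinable if each $p\in\Omega$ has a tiling $\overline t_p$ with atomic pieces; this is assumed throughout. Given a choice of such tilings, $\overline\Omega=\bigcup_{p\in\Omega}\Omega(\overline t_p)$ is the atomic refinement of $\Omega$ induced by $\{\overline t_p\}$. **Stitching.** The stitching of a tiling with $\overline\Omega$ is obtained by replacing every pair of regular atomic pieces sharing a $2$-valued side by the $\mathbb{F}_2$-valued unit rhombus they form. $\tilde t_p$ denotes the stitching of $\overline t_p$. **Implicit, separable, forbidden.** For $p\in\Omega_b$, the pieces in $\Omega_i(\overline t_p)=\Omega(\tilde t_p)\setminus\Omega$ are implicit w.r.t. $\overline t_p$; $\overline\Omega_i$ is the union of these sets. (The implicit pieces used below are the $(2,2,2)$-valued atomic pieces and the $\mathbb{F}_2$-valued rhombuses.) $\overline\Omega$ is separable if (1) every piece implicit w.r.t. $\overline t_p$ occurs only once in $\tilde t_p$, and (2) $\Omega_i(\overline t_p)\cap\Omega_i(\overline t_q)=\emptyset$ for distinct $p,q\in\Omega_b$. Let $\overline\Omega_r$ be the set of $\mathbb{F}_2$-valued unit rhombus pieces that have a tiling with $\overline\Omega$ but not with $\Omega$; the forbidden pieces are those in $\overline\Omega_f=\overline\Omega_r\setminus\overline\Omega_i$. **Distinguishing polynomials.** An upward (downward) atomic piece is identified with the vector of values of its left, right, bottom (left,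 top, right) sides. An upward (downward) distinguishing polynomial w.r.t. $\overline\Omega$ is $f\in\mathbb{F}_3[x,y,z]/\langle x^3-x,y^3-y,z^3-z\rangle$ such that for each upward (downward) atomic piece $a$: $f(a)=0$ iff $a\in\overline\Omega$. **Forbidding polynomials.** Let $\Psi$ be the set of $\mathbb{F}_3$-valued unit rhombus pieces having a tiling with $\overline\Omega$, and $\Psi_l,\Psi_r,\Psi_b$ its subsets with middle interval parallel to the left, right, bottom side of the big triangle. A piece in $\Psi_l$ or $\Psi_r$ is identified with the vector of its top, right, bottom, left values; a piece in $\Psi_b$ with its NW, NE, SE, SW values. A left (right, bottom) forbidding polynomial is $f\in\mathbb{F}_3[z_1,\dots,z_4]/\langle z_i^3-z_i\rangle$ such that for each $a\in\Psi_l$ ($\Psi_r,\Psi_b$): $f(a)\ne0$ iff $a\in\overline\Omega_f$. **Implying polynomials.** Let the polygon shape of $\Omega_b$ have $m$ unit intervals $I_1,\dots,I_m$ (boundary and interior). For an implicit piece $\overline p$ corresponding to the unique $p\in\Omega_b$ with $\overline p\in\Omega_i(\overline t_p)$, let $\overline{\boldsymbol x}\in\mathbb{F}_3^m$ be the values assigned by $\overline t_p$ to $I_1,\dots,I_m$, and let $K\subseteq\{1,\dots,m\}$ index the boundary intervals of the unique occurrence of $\overline p$ in $\tilde t_p$ ($|K|=4$ for a rhombus, $3$ for the $(2,2,2)$-valued piece). An implying polynomial of $\overline p$ is $f_{\overline p}\in\mathbb{F}_3[z_1,\dots,z_m]/\langle z_i^3-z_i\rangle$ with $f_{\overline p}(\overline{\boldsymbol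 x})=0$ and $f_{\overline p}(\boldsymbol z)=1$ for every $\boldsymbol z\neq\overline{\boldsymbol x}$ in $\mathbb{F}_3^m$ agreeing with $\overline{\boldsymbol x}$ on $K$. **Ideals.** Introduce variables $\boldsymbol x=\{x_1,\dots,x_N\}$, one per unit interval; $x_{lj},x_{rj},x_{bj}$ are the variables of the $j$-th intervals (left to right) of the left, right, bottom sides. Fix choices of distinguishing, forbidding and implying polynomials (the same for all ideals below). Set: $\mathcal F_1=\{x_i^3-x_i: 1\le i\le N\}$; $\mathcal F_2=\{x_{lj}-\lambda_j,\ x_{rj}-\mu_j,\ x_{bj}-\nu_j: 1\le j\le n\}$; $\tilde{\mathcal F}_1$ = $\mathcal F_1$ with $x_{bj}^3-x_{bj}$ replaced by $x_{bj}^2-x_{bj}$ ($1\le j\le n$); $\tilde{\mathcal F}_2$ = $\mathcal F_2$ with the polynomials $x_{bj}-\nu_j$ removed; $\mathcal F_3$ = for each unit triangle, the sum of its three side variables; $\mathcal F_4$ = for each upward (downward) unit triangle, the upward (downward) distinguishing polynomial evaluated at its side variables; $\mathcal F_5$ = for each unit rhombus inside the big triangle of left/right/bottom type, the corresponding forbidding polynomial evaluated at its four boundary variables; $\mathcal F_6$ = for each implicit piece $\overline p$ and each translate inside the big triangle of the polygon shape of $\Omega_b$, $f_{\overline p}$ evaluated at the $m$ variables of that polygon. The puzzle ideal is $I^{\nu,\Omega}_{\lambda\mu}=\langle\mathcal F_1\cup\dots\cup\mathcal F_6\rangle$ and the $\nu$-free puzzle ideal is $I^{\emptyset,\Omega}_{\lambda\mu}=\langle\tilde{\mathcal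 F}_1\cup\tilde{\mathcal F}_2\cup\mathcal F_3\cup\dots\cup\mathcal F_6\rangle$, both in $\mathbb{F}_3[\boldsymbol x]$. $V(I^{\emptyset,\Omega})$ is the set of common zeros in $\mathbb{F}_3^n$; the prime corresponding to $\overline\nu_k$ is $\langle x_{b1}-\overline\nu_{k1},\dots,x_{bn}-\overline\nu_{kn}\rangle$. -}

module Defs where

open import Level using (0ℓ)
open import Algebra.Bundles using (CommutativeRing)
open import Data.Empty using (⊥)
open import Data.Fin.Base using (Fin; toℕ; inject₁; opposite)
open import Data.Fin.Patterns using (0F; 1F; 2F; 3F)
import Data.Fin.Properties as Fin
open import Data.List.Base using (List; []; _∷_; length; map; filter; concatMap; cartesianProduct; cartesianProductWith; upTo; _++_)
open import Data.List.Membership.Propositional using (_∈_; _∉_)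
import Data.List.Membership.DecPropositional as DecMembership
open import Data.List.Relation.Unary.Any using (any?)
open import Data.Nat.Base using (ℕ; suc; z≤n; s≤s; _<_; _≤_)
import Data.Nat.Base as ℕ
open import Data.Nat.DivMod using (_mod_)
import Data.Nat.Properties as ℕ
open import Data.Product.Base using (Σ; ∃; _×_; _,_; proj₁; proj₂)
import Data.Product.Properties as Product
open import Data.Sum.Base using (_⊎_)
open import Data.Vec.Base using (Vec; fromList; lookup; foldr′)
import Data.Vec.Base as Vec
open import Data.Vec.Properties using (≡-dec)
import Data.Vec.Relation.Unary.All as VecAll
open import Function.Base using (_∘_)
open import Function.Bundles using (_⇔_)
open import Relation.Binary.Definitions using (DecidableEquality)
open import Relation.Binary.PropositionalEquality
  using (_≡_; _≢_; refl; sym; trans; cong; subst)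
open import Relation.Nullary using (¬_; yes; no)
open import Relation.Nullary.Decidable using (map′; _×-dec_; _⊎-dec_; ¬?)
open import Relation.Unary using (Pred; Decidable; _⊆_; _≐_; _∪_; ⋂)

------------------------------------------------------------------------
-- The fields with two and three elements

F₂ F₃ : Set
F₂ = Fin 2
F₃ = Fin 3

infixl 6 _+₃_
infixl 7 _*₃_

_+₃_ _*₃_ : F₃ → F₃ → F₃
a +₃ b = (toℕ a ℕ.+ toℕ b) mod 3
a *₃ b = (toℕ a ℕ.* toℕ b) mod 3

-₃_ : F₃ → F₃
-₃ a = (3 ℕ.∸ toℕ a) mod 3

ι₂₃ : F₂ → F₃
ι₂₃ = inject₁

------------------------------------------------------------------------
-- Polynomial rings over F₃

-- The polynomial ring with a set X of variables, as the free commutative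
-- F₃-algebra on X: expressions modulo the congruence generated by the
-- commutative ring laws and the operations of F₃.

infixl 6 _⊕_ _⊖_
infixl 7 _⊗_

data Poly (X : Set) : Set where
  con     : F₃ → Poly X
  var     : X → Poly X
  _⊕_ _⊗_ : Poly X → Poly X → Poly X
  neg     : Poly X → Poly X

infix 4 _≈_

data _≈_ {X : Set} : Poly X → Poly X → Set where
  ≈-refl      : ∀ {f} → f ≈ f
  ≈-sym       : ∀ {f g} → f ≈ g → g ≈ f
  ≈-trans     : ∀ {f g h} → f ≈ g → g ≈ h → f ≈ h
  ⊕-cong      : ∀ {f f′ g g′} → f ≈ f′ → g ≈ g′ → f ⊕ g ≈ f′ ⊕ g′
  ⊗-cong      : ∀ {f f′ g g′} → f ≈ f′ → g ≈ g′ → f ⊗ g ≈ f′ ⊗ g′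
  neg-cong    : ∀ {f f′} → f ≈ f′ → neg f ≈ neg f′
  ⊕-assoc     : ∀ f g h → (f ⊕ g) ⊕ h ≈ f ⊕ (g ⊕ h)
  ⊕-comm      : ∀ f g → f ⊕ g ≈ g ⊕ f
  ⊕-identityˡ : ∀ f → con 0F ⊕ f ≈ f
  ⊕-inverseˡ  : ∀ f → neg f ⊕ f ≈ con 0F
  ⊗-assoc     : ∀ f g h → (f ⊗ g) ⊗ h ≈ f ⊗ (g ⊗ h)
  ⊗-comm      : ∀ f g → f ⊗ g ≈ g ⊗ f
  ⊗-identityˡ : ∀ f → con 1F ⊗ f ≈ f
  ⊗-distribˡ  : ∀ f g h → f ⊗ (g ⊕ h) ≈ (f ⊗ g) ⊕ (f ⊗ h)
  con-⊕       : ∀ a b → con (a +₃ b) ≈ con a ⊕ con b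
  con-⊗       : ∀ a b → con (a *₃ b) ≈ con a ⊗ con b

_⊖_ : ∀ {X} → Poly X → Poly X → Poly X
f ⊖ g = f ⊕ neg g

F₃[_] : Set → CommutativeRing 0ℓ 0ℓ
F₃[ X ] = record
  { Carrier = Poly X ; _≈_ = _≈_ ; _+_ = _⊕_ ; _*_ = _⊗_ ; -_ = neg
  ; 0# = con 0F ; 1# = con 1F
  ; isCommutativeRing = record
    { isRing = record
      { +-isAbelianGroup = record
        { isGroup = record
          { isMonoid = record
            { isSemigroup = record
              { isMagma = record
                { isEquivalence = record { refl = ≈-refl ; sym = ≈-sym ; trans = ≈-trans }
                ; ∙-cong = ⊕-cong }
              ; assoc = ⊕-assoc }
            ; identity = ⊕-identityˡ , λ f → ≈-trans (⊕-comm f _) (⊕-identityˡ f) }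
          ; inverse = ⊕-inverseˡ , λ f → ≈-trans (⊕-comm f _) (⊕-inverseˡ f)
          ; ⁻¹-cong = neg-cong }
        ; comm = ⊕-comm }
      ; *-cong = ⊗-cong
      ; *-assoc = ⊗-assoc
      ; *-identity = ⊗-identityˡ , λ f → ≈-trans (⊗-comm f _) (⊗-identityˡ f)
      ; distrib = ⊗-distribˡ , λ f g h →
          ≈-trans (⊗-comm (g ⊕ h) f)
            (≈-trans (⊗-distribˡ f g h) (⊕-cong (⊗-comm f g) (⊗-comm f h))) }
    ; *-comm = ⊗-comm } }

eval : ∀ {X} → Poly X → (X → F₃) → F₃
eval (con a) x = a
eval (var i) x = x i
eval (f ⊕ g) x = eval f x +₃ eval g x
eval (f ⊗ g) x = eval f x *₃ eval g x
eval (neg f) x = -₃ eval f x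

rename : ∀ {X Y} → (X → Y) → Poly X → Poly Y
rename ρ (con a) = con a
rename ρ (var i) = var (ρ i)
rename ρ (f ⊕ g) = rename ρ f ⊕ rename ρ g
rename ρ (f ⊗ g) = rename ρ f ⊗ rename ρ g
rename ρ (neg f) = neg (rename ρ f)

------------------------------------------------------------------------
-- Ideals of a commutative ring

module Ideals (R : CommutativeRing 0ℓ 0ℓ) where
  open CommutativeRing R renaming (_≈_ to _≃_)
  open import Algebra.Properties.Semiring.Exp semiring using (_^_)

  record IsIdeal (I : Pred Carrier 0ℓ) : Set where
    field
      resp     : ∀ {f g} → f ≃ g → I f → I g
      zero-mem : I 0#
      +-mem    : ∀ {f g} → I f → I g → I (f + g)
      *-mem    : ∀ h {f} → I f → I (h * f)

  data ⟨_⟩ (S : Pred Carrier 0ℓ) : Pred Carrier 0ℓ where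
    gen      : ∀ {f} → S f → ⟨ S ⟩ f
    resp     : ∀ {f g} → f ≃ g → ⟨ S ⟩ f → ⟨ S ⟩ g
    zero-mem : ⟨ S ⟩ 0#
    +-mem    : ∀ {f g} → ⟨ S ⟩ f → ⟨ S ⟩ g → ⟨ S ⟩ (f + g)
    *-mem    : ∀ h {f} → ⟨ S ⟩ f → ⟨ S ⟩ (h * f)

  record IsRadical (I : Pred Carrier 0ℓ) : Set where
    field
      isIdeal : IsIdeal I
      radical : ∀ f m → I (f ^ m) → I f

  record IsPrime (I : Pred Carrier 0ℓ) : Set where
    field
      isIdeal : IsIdeal I
      proper  : ¬ I 1#
      prime   : ∀ f g → I (f * g) → I f ⊎ I g

  -- The empty family (s = 0) decomposes the unit ideal.
  record IsPrimeDecomposition (I : Pred Carrier 0ℓ) {s : ℕ}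
                              (𝔭 : Fin s → Pred Carrier 0ℓ) : Set where
    field
      isPrime      : ∀ i → IsPrime (𝔭 i)
      intersection : I ≐ ⋂ (Fin s) 𝔭
      irredundant  : ∀ i j → 𝔭 i ⊆ 𝔭 j → i ≡ j

open Ideals public using (IsIdeal; IsRadical; IsPrime; IsPrimeDecomposition)

⟨_⟩ : ∀ {X} → Pred (Poly X) 0ℓ → Pred (Poly X) 0ℓ
⟨_⟩ {X} = Ideals.⟨_⟩ F₃[ X ]

------------------------------------------------------------------------
-- The triangular lattice

-- Row r counts upwards and column c to the right, along the two sides of
-- a 60 degree angle.  The lattice point (r , c) is the lower left corner
-- of the upward unit triangle (△ , r , c); the downward unit triangle
-- (▽ , r , c) is the one sharing the right side of (△ , r , c).

data Orient : Set where
  △ ▽ : Orient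

data Dir : Set where
  left right bottom : Dir

Offset Cell Edge : Set
Offset = ℕ × ℕ
Cell   = Orient × Offset
Edge   = Dir × Offset

-- The edge (d , r , c) is the d-side of the upward triangle (△ , r , c);
-- every unit interval of the lattice arises exactly once in this way.
-- For a downward triangle, side c d is its side parallel to d-sides of
-- upward triangles: "right" is its left side, "bottom" its top side and
-- "left" its right side.
side : Cell → Dir → Edge
side (△ , r , c) d      = d , r , c
side (▽ , r , c) left   = left , r , suc c
side (▽ , r , c) right  = right , r , c
side (▽ , r , c) bottom = bottom , suc r , c

shift : ∀ {A : Set} → Offset → A × Offset → A × Offset
shift (i , j) (a , r , c) = a , i ℕ.+ r , j ℕ.+ c

infix 4 _≟ᵒ_ _≟ᵈ_ _≟ᵉ_ _≟ᶜ_

_≟ᵒ_ : DecidableEquality Orient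
△ ≟ᵒ △ = yes refl
△ ≟ᵒ ▽ = no λ ()
▽ ≟ᵒ △ = no λ ()
▽ ≟ᵒ ▽ = yes refl

_≟ᵈ_ : DecidableEquality Dir
left   ≟ᵈ left   = yes refl
left   ≟ᵈ right  = no λ ()
left   ≟ᵈ bottom = no λ ()
right  ≟ᵈ left   = no λ ()
right  ≟ᵈ right  = yes refl
right  ≟ᵈ bottom = no λ ()
bottom ≟ᵈ left   = no λ ()
bottom ≟ᵈ right  = no λ ()
bottom ≟ᵈ bottom = yes refl

_≟ᵉ_ : DecidableEquality Edge
_≟ᵉ_ = Product.≡-dec _≟ᵈ_ (Product.≡-dec ℕ._≟_ ℕ._≟_)

_≟ᶜ_ : DecidableEquality Cell
_≟ᶜ_ = Product.≡-dec _≟ᵒ_ (Product.≡-dec ℕ._≟_ ℕ._≟_)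

------------------------------------------------------------------------
-- Convex polygons with sides parallel to those of the big triangle

-- Up to translation such a polygon is
--   { (r , c) | 0 ≤ r ≤ height , 0 ≤ c ≤ width , lo ≤ r + c ≤ hi }.
record Hexagon : Set where
  constructor hexagon
  field
    height width lo hi : ℕ

open Hexagon

-- The six bounds are attained, and the region has positive width in each
-- of the three directions.  The corners are then lattice points, and
-- distinct parameters give distinct polygons.  Sides of the hexagon may
-- have length 0, so triangles, rhombuses etc. are included.
record IsPolygon (P : Hexagon) : Set where
  field
    lo≤height       : lo P ≤ height P
    lo≤width        : lo P ≤ width P
    height≤hi       : height P ≤ hi P
    width≤hi        : width P ≤ hi P
    hi≤height+width : hi P ≤ height P ℕ.+ width P
    0<height        : 0 < height P
    0<width         : 0 < width P
    lo<hi           : lo P < hi P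

-- r + c is in [level , level + 1] on the whole unit triangle.
level : Cell → ℕ
level (△ , r , c) = r ℕ.+ c
level (▽ , r , c) = suc (r ℕ.+ c)

CellIn : Hexagon → Pred Cell 0ℓ
CellIn P t@(_ , r , c) =
  r < height P × c < width P × lo P ≤ level t × level t < hi P

cellIn? : ∀ P → Decidable (CellIn P)
cellIn? P t@(_ , r , c) =
  r ℕ.<? height P ×-dec c ℕ.<? width P ×-dec lo P ℕ.≤? level t ×-dec level t ℕ.<? hi P

cells : Hexagon → List Cell
cells P = filter (cellIn? P)
  (cartesianProduct (△ ∷ ▽ ∷ []) (cartesianProduct (upTo (height P)) (upTo (width P))))

-- Interior unit intervals occur twice in this list.
cellSides : Hexagon → List Edge
cellSides P = cartesianProductWith side (cells P) (left ∷ right ∷ bottom ∷ [])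

boundary : Hexagon → List Edge
boundary P = filter (λ e → length (filter (e ≟ᵉ_) (cellSides P)) ℕ.≟ 1) (cellSides P)

-- All unit intervals of P, interior ones included.
record EdgeOf (P : Hexagon) : Set where
  constructor edgeOf
  field
    edge    : Edge
    .inside : ∃ λ t → CellIn P t × ∃ λ d → side t d ≡ edge

open EdgeOf public using (edge)

-- The translate of P by the offset (i , j) lies inside Q.  (For bounds
-- that are attained; the bounds r ≥ 0 and c ≥ 0 hold automatically.)
record Fits (P : Hexagon) (o : Offset) (Q : Hexagon) : Set where
  private
    i = proj₁ o
    j = proj₂ o
  field
    fit-height : i ℕ.+ height P ≤ height Q
    fit-width  : j ℕ.+ width P ≤ width Q
    fit-lo     : lo Q ≤ (i ℕ.+ j) ℕ.+ lo P
    fit-hi     : (i ℕ.+ j) ℕ.+ hi P ≤ hi Q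

private
  interchange : ∀ i j r c → (i ℕ.+ r) ℕ.+ (j ℕ.+ c) ≡ (i ℕ.+ j) ℕ.+ (r ℕ.+ c)
  interchange i j r c = trans (ℕ.+-assoc i r (j ℕ.+ c))
    (trans (cong (i ℕ.+_) (trans (sym (ℕ.+-assoc r j c))
      (trans (cong (ℕ._+ c) (ℕ.+-comm r j)) (ℕ.+-assoc j r c))))
    (sym (ℕ.+-assoc i j (r ℕ.+ c))))

  level-shift : ∀ i j t → level (shift (i , j) t) ≡ (i ℕ.+ j) ℕ.+ level t
  level-shift i j (△ , r , c) = interchange i j r c
  level-shift i j (▽ , r , c) =
    trans (cong suc (interchange i j r c)) (sym (ℕ.+-suc (i ℕ.+ j) (r ℕ.+ c)))

  side-shift : ∀ o t d → side (shift o t) d ≡ shift o (side t d)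
  side-shift (i , j) (△ , r , c) d      = refl
  side-shift (i , j) (▽ , r , c) left   = cong (λ m → left , i ℕ.+ r , m) (sym (ℕ.+-suc j c))
  side-shift (i , j) (▽ , r , c) right  = refl
  side-shift (i , j) (▽ , r , c) bottom = cong (λ m → bottom , m , j ℕ.+ c) (sym (ℕ.+-suc i r))

cellIn-shift : ∀ {P Q} o → Fits P o Q → ∀ t → CellIn P t → CellIn Q (shift o t)
cellIn-shift {P} {Q} (i , j) fits t@(_ , r , c) (r< , c< , lo≤ , <hi) =
  ℕ.<-≤-trans (ℕ.+-monoʳ-< i r<) fit-height ,
  ℕ.<-≤-trans (ℕ.+-monoʳ-< j c<) fit-width ,
  subst (lo Q ≤_) (sym (level-shift i j t)) (ℕ.≤-trans fit-lo (ℕ.+-monoʳ-≤ (i ℕ.+ j) lo≤)) ,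
  subst (_< hi Q) (sym (level-shift i j t)) (ℕ.<-≤-trans (ℕ.+-monoʳ-< (i ℕ.+ j) <hi) fit-hi)
  where open Fits fits

shiftEdge : ∀ {P Q} o → .(Fits P o Q) → EdgeOf P → EdgeOf Q
shiftEdge o fits (edgeOf e inside) = edgeOf (shift o e)
  (let (t , t∈P , d , eq) = inside in
   shift o t , cellIn-shift o fits t t∈P , d , trans (side-shift o t d) (cong (shift o) eq))

infix 4 _≟ʰ_

_≟ʰ_ : DecidableEquality Hexagon
hexagon h w l k ≟ʰ hexagon h′ w′ l′ k′ =
  map′ (λ { (refl , refl , refl , refl) → refl }) (λ { refl → refl , refl , refl , refl })
    (h ℕ.≟ h′ ×-dec w ℕ.≟ w′ ×-dec l ℕ.≟ l′ ×-dec k ℕ.≟ k′)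

unit : Orient → Hexagon
unit △ = hexagon 1 1 0 1
unit ▽ = hexagon 1 1 1 2

-- The left, right, bottom sides of △ and the left, top, right sides of ▽.
unitSides : ∀ τ → Fin 3 → EdgeOf (unit τ)
unitSides △ 0F = edgeOf (left , 0 , 0) ((△ , 0 , 0) , (s≤s z≤n , s≤s z≤n , z≤n , s≤s z≤n) , left , refl)
unitSides △ 1F = edgeOf (right , 0 , 0) ((△ , 0 , 0) , (s≤s z≤n , s≤s z≤n , z≤n , s≤s z≤n) , right , refl)
unitSides △ 2F = edgeOf (bottom , 0 , 0) ((△ , 0 , 0) , (s≤s z≤n , s≤s z≤n , z≤n , s≤s z≤n) , bottom , refl)
unitSides ▽ 0F = edgeOf (right , 0 , 0) ((▽ , 0 , 0) , (s≤s z≤n , s≤s z≤n , s≤s z≤n , s≤s (s≤s z≤n)) , right , refl)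
unitSides ▽ 1F = edgeOf (bottom , 1 , 0) ((▽ , 0 , 0) , (s≤s z≤n , s≤s z≤n , s≤s z≤n , s≤s (s≤s z≤n)) , bottom , refl)
unitSides ▽ 2F = edgeOf (left , 0 , 1) ((▽ , 0 , 0) , (s≤s z≤n , s≤s z≤n , s≤s z≤n , s≤s (s≤s z≤n)) , left , refl)

-- The unit rhombus whose middle interval is parallel to the d-side of the
-- big triangle.  Its downward half is (▽ , 0 , 0), its upward half is
-- (△ , upper d), and the middle interval is (d , upper d).
rhombus : Dir → Hexagon
rhombus left   = hexagon 1 2 1 2
rhombus right  = hexagon 1 1 0 2
rhombus bottom = hexagon 2 1 1 2

upper : Dir → Offset
upper left   = 0 , 1
upper right  = 0 , 0
upper bottom = 1 , 0

-- The top, right, bottom, left sides (d = left, right), respectively the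
-- NW, NE, SE, SW sides (d = bottom).
rhombusSides : ∀ d → Fin 4 → EdgeOf (rhombus d)
rhombusSides left 0F = edgeOf (bottom , 1 , 0) ((▽ , 0 , 0) , (s≤s z≤n , s≤s z≤n , s≤s z≤n , s≤s (s≤s z≤n)) , bottom , refl)
rhombusSides left 1F = edgeOf (right , 0 , 1) ((△ , 0 , 1) , (s≤s z≤n , s≤s (s≤s z≤n) , s≤s z≤n , s≤s (s≤s z≤n)) , right , refl)
rhombusSides left 2F = edgeOf (bottom , 0 , 1) ((△ , 0 , 1) , (s≤s z≤n , s≤s (s≤s z≤n) , s≤s z≤n , s≤s (s≤s z≤n)) , bottom , refl)
rhombusSides left 3F = edgeOf (right , 0 , 0) ((▽ , 0 , 0) , (s≤s z≤n , s≤s z≤n , s≤s z≤n , s≤s (s≤s z≤n)) , right , refl)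
rhombusSides right 0F = edgeOf (bottom , 1 , 0) ((▽ , 0 , 0) , (s≤s z≤n , s≤s z≤n , z≤n , s≤s (s≤s z≤n)) , bottom , refl)
rhombusSides right 1F = edgeOf (left , 0 , 1) ((▽ , 0 , 0) , (s≤s z≤n , s≤s z≤n , z≤n , s≤s (s≤s z≤n)) , left , refl)
rhombusSides right 2F = edgeOf (bottom , 0 , 0) ((△ , 0 , 0) , (s≤s z≤n , s≤s z≤n , z≤n , s≤s z≤n) , bottom , refl)
rhombusSides right 3F = edgeOf (left , 0 , 0) ((△ , 0 , 0) , (s≤s z≤n , s≤s z≤n , z≤n , s≤s z≤n) , left , refl)
rhombusSides bottom 0F = edgeOf (left , 1 , 0) ((△ , 1 , 0) , (s≤s (s≤s z≤n) , s≤s z≤n , s≤s z≤n , s≤s (s≤s z≤n)) , left , refl)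
rhombusSides bottom 1F = edgeOf (right , 1 , 0) ((△ , 1 , 0) , (s≤s (s≤s z≤n) , s≤s z≤n , s≤s z≤n , s≤s (s≤s z≤n)) , right , refl)
rhombusSides bottom 2F = edgeOf (left , 0 , 1) ((▽ , 0 , 0) , (s≤s z≤n , s≤s z≤n , s≤s z≤n , s≤s (s≤s z≤n)) , left , refl)
rhombusSides bottom 3F = edgeOf (right , 0 , 0) ((▽ , 0 , 0) , (s≤s z≤n , s≤s z≤n , s≤s z≤n , s≤s (s≤s z≤n)) , right , refl)

bigTriangle : ℕ → Hexagon
bigTriangle n = hexagon n n 0 n

module _ {n : ℕ} where

  private
    in-left : ∀ (j : Fin n) → CellIn (bigTriangle n) (△ , toℕ j , 0)
    in-left j = Fin.toℕ<n j , ℕ.≤-<-trans z≤n (Fin.toℕ<n j) , z≤n ,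
      subst (_< n) (sym (ℕ.+-identityʳ (toℕ j))) (Fin.toℕ<n j)

    in-right : ∀ (j : Fin n) → CellIn (bigTriangle n) (△ , toℕ (opposite j) , toℕ j)
    in-right j = Fin.toℕ<n (opposite j) , Fin.toℕ<n j , z≤n ,
      ℕ.≤-reflexive (trans (sym (ℕ.+-suc (toℕ (opposite j)) (toℕ j)))
        (trans (cong (ℕ._+ suc (toℕ j)) (Fin.opposite-prop j)) (ℕ.m∸n+n≡m (Fin.toℕ<n j))))

    in-bottom : ∀ (j : Fin n) → CellIn (bigTriangle n) (△ , 0 , toℕ j)
    in-bottom j = ℕ.≤-<-trans z≤n (Fin.toℕ<n j) , Fin.toℕ<n j , z≤n , Fin.toℕ<n j

  -- Each side is read from left to right, so the left side is read upwards
  -- and the right side downwards.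
  leftEdge rightEdge bottomEdge : Fin n → EdgeOf (bigTriangle n)
  leftEdge   j = edgeOf (left , toℕ j , 0) ((△ , toℕ j , 0) , in-left j , left , refl)
  rightEdge  j = edgeOf (right , toℕ (opposite j) , toℕ j)
    ((△ , toℕ (opposite j) , toℕ j) , in-right j , right , refl)
  bottomEdge j = edgeOf (bottom , 0 , toℕ j) ((△ , 0 , toℕ j) , in-bottom j , bottom , refl)

------------------------------------------------------------------------
-- Puzzle pieces and tilings

-- A polygon with a value on each unit interval of its boundary, listed in
-- the order of the list boundary.
Piece : Set → Set
Piece A = Σ Hexagon λ P → Vec A (length (boundary P))

shape : ∀ {A} → Piece A → Hexagon
shape = proj₁

values : ∀ {A} (p : Piece A) → Vec A (length (boundary (shape p)))
values = proj₂

embed : Piece F₂ → Piece F₃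
embed (P , v) = P , Vec.map ι₂₃ v

infix 4 _≟ᵖ_

_≟ᵖ_ : DecidableEquality (Piece F₃)
_≟ᵖ_ = Product.≡-dec _≟ʰ_ (≡-dec Fin._≟_)

pieceOf : ∀ {A} → Hexagon → (Edge → A) → Piece A
pieceOf P v = P , Vec.map v (fromList (boundary P))

Tile : Set
Tile = Hexagon × Offset

infix 4 _≟ᵗ_

_≟ᵗ_ : DecidableEquality Tile
_≟ᵗ_ = Product.≡-dec _≟ʰ_ (Product.≡-dec ℕ._≟_ ℕ._≟_)

tileCells : Tile → List Cell
tileCells (P , o) = map (shift o) (cells P)

-- Tiles are translates of polygons, and the piece placed at a tile has the
-- values found on its boundary.  As there is one value per unit interval
-- of the lattice, values on common edges match.  The values outside of the
-- tiled polygon and in the interior of tiles play no role.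
record Tiling (A : Set) : Set where
  field
    value : Edge → A
    tiles : List Tile

  pieceAt : Tile → Piece A
  pieceAt (P , o) = pieceOf P (value ∘ shift o)

  pieces : List (Piece A)
  pieces = map pieceAt tiles

open Tiling public

covering : Cell → List Tile → List Tile
covering t = filter (λ T → DecMembership._∈?_ _≟ᶜ_ t (tileCells T))

record IsTiling {A : Set} (Ω : Pred (Piece A) 0ℓ) (p : Piece A) (t : Tiling A) : Set where
  field
    fits       : ∀ {P o} → (P , o) ∈ tiles t → Fits P o (shape p)
    covers     : ∀ c → CellIn (shape p) c → length (covering c (tiles t)) ≡ 1
    prescribed : pieceOf (shape p) (value t) ≡ p
    pieces∈Ω   : ∀ {q} → q ∈ pieces t → Ω q

HasTiling : ∀ {A} → Pred (Piece A) 0ℓ → Pred (Piece A) 0ℓ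
HasTiling Ω p = ∃ (IsTiling Ω p)

------------------------------------------------------------------------
-- Atomic pieces and stitching

IsUnit IsRhombus : Pred Hexagon 0ℓ
IsUnit    P = P ≡ unit △ ⊎ P ≡ unit ▽
IsRhombus P = ∃ λ d → P ≡ rhombus d

Constant : F₃ → Pred (Piece F₃) 0ℓ
Constant a p = VecAll.All (_≡ a) (values p)

Atomic Regular : Pred (Piece F₃) 0ℓ
Atomic  p = IsUnit (shape p) × foldr′ _+₃_ 0F (values p) ≡ 0F
Regular p = Atomic p × ∀ a → ¬ Constant a p

regular? : Decidable Regular
regular? p =
  ((shape p ≟ʰ unit △ ⊎-dec shape p ≟ʰ unit ▽) ×-dec foldr′ _+₃_ 0F (values p) Fin.≟ 0F)
  ×-dec Fin.all? (λ a → ¬? (VecAll.all? (Fin._≟ a) (values p)))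

lowerHalf upperHalf : Dir × Offset → Tile
lowerHalf (d , o) = unit ▽ , o
upperHalf (d , o) = unit △ , proj₂ (shift o (d , upper d))

module _ (t : Tiling F₃) where

  -- The rhombus of type d at o consists of two regular atomic pieces of t
  -- sharing a 2-valued side.
  Stitched : Pred (Dir × Offset) 0ℓ
  Stitched (d , o) =
    lowerHalf (d , o) ∈ tiles t × upperHalf (d , o) ∈ tiles t ×
    Regular (pieceAt t (lowerHalf (d , o))) × Regular (pieceAt t (upperHalf (d , o))) ×
    value t (shift o (d , upper d)) ≡ 2F

  stitched? : Decidable Stitched
  stitched? (d , o) =
    lowerHalf (d , o) ∈? tiles t ×-dec upperHalf (d , o) ∈? tiles t ×-dec
    regular? (pieceAt t (lowerHalf (d , o))) ×-dec regular? (pieceAt t (upperHalf (d , o))) ×-dec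
    value t (shift o (d , upper d)) Fin.≟ 2F
    where open DecMembership _≟ᵗ_ using (_∈?_)

  stitchedRhombi : List (Dir × Offset)
  stitchedRhombi = filter stitched?
    (cartesianProduct (left ∷ right ∷ bottom ∷ [])
      (map proj₂ (filter (λ T → proj₁ T ≟ʰ unit ▽) (tiles t))))

  -- A regular piece has exactly one 2-valued side, so that every tile of t
  -- is part of at most one stitched rhombus.
  stitching : Tiling F₃
  stitching = record
    { value = value t
    ; tiles = map (λ (d , o) → rhombus d , o) stitchedRhombi
        ++ filter (λ T → ¬? (any? (λ r → T ≟ᵗ lowerHalf r ⊎-dec T ≟ᵗ upperHalf r) stitchedRhombi))
             (tiles t) }

------------------------------------------------------------------------
-- Puzzles and their atomic refinements

-- B is the shape of the pieces in Ω_b.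
record IsPuzzle (B : Hexagon) (Ω : List (Piece F₂)) : Set where
  field
    isPolygon : IsPolygon B
    bigger    : 2 < length (cells B)
    shapes    : ∀ {p} → p ∈ Ω → IsUnit (shape p) ⊎ IsRhombus (shape p) ⊎ shape p ≡ B

-- The chosen atomic tiling of p is t̄ p; only the values of t̄ at the
-- elements of Ω are used.
IsRefinement : List (Piece F₂) → (Piece F₂ → Tiling F₃) → Set
IsRefinement Ω t̄ = ∀ {p} → p ∈ Ω → IsTiling Atomic (embed p) (t̄ p)

module Refinement (B : Hexagon) (Ω : List (Piece F₂)) (t̄ : Piece F₂ → Tiling F₃) where

  Ωb : Pred (Piece F₂) 0ℓ
  Ωb p = p ∈ Ω × shape p ≡ B

  Ω̄ : Pred (Piece F₃) 0ℓ
  Ω̄ a = ∃ λ p → p ∈ Ω × a ∈ pieces (t̄ p)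

  t̃ : Piece F₂ → Tiling F₃
  t̃ p = stitching (t̄ p)

  -- Regular atomic pieces left over by the stitching (those next to a
  -- (2,2,2)-valued piece) are never in Ω, but do not count as implicit:
  -- only (2,2,2)-valued atomic pieces and F₂-valued rhombuses do.
  ImplicitKind : Pred (Piece F₃) 0ℓ
  ImplicitKind q =
    (IsUnit (shape q) × Constant 2F q) ⊎
    (IsRhombus (shape q) × VecAll.All (_≢ 2F) (values q))

  Implicit : Piece F₂ → Pred (Piece F₃) 0ℓ
  Implicit p q = q ∈ pieces (t̃ p) × q ∉ map embed Ω × ImplicitKind q

  record IsSeparable : Set where
    field
      once     : ∀ {p q} → Ωb p → Implicit p q →
                 length (filter (q ≟ᵖ_) (pieces (t̃ p))) ≡ 1
      disjoint : ∀ {p p′ q} → Ωb p → Ωb p′ → p ≢ p′ →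
                 Implicit p q → Implicit p′ q → ⊥

  Ω̄i : Pred (Piece F₃) 0ℓ
  Ω̄i q = ∃ λ p → Ωb p × Implicit p q

  Ω̄r Ω̄f : Pred (Piece F₂) 0ℓ
  Ω̄r p = IsRhombus (shape p) × HasTiling Ω̄ (embed p) × ¬ HasTiling (_∈ Ω) p
  Ω̄f p = Ω̄r p × ¬ Ω̄i (embed p)

  -- Elements of F₃[z₁,…,zₘ] / ⟨ zᵢ³ - zᵢ ⟩ are given by representatives in
  -- the three definitions below.

  IsDistinguishing : Orient → Poly (Fin 3) → Set
  IsDistinguishing τ f = (v : Edge → F₃) → Atomic (pieceOf (unit τ) v) →
    eval f (v ∘ edge ∘ unitSides τ) ≡ 0F ⇔ Ω̄ (pieceOf (unit τ) v)

  IsForbidding : Dir → Poly (Fin 4) → Set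
  IsForbidding d f = (v : Edge → F₃) → HasTiling Ω̄ (pieceOf (rhombus d) v) →
    eval f (v ∘ edge ∘ rhombusSides d) ≢ 0F ⇔
    ∃ λ p → Ω̄f p × embed p ≡ pieceOf (rhombus d) v

  -- The variables are indexed by all unit intervals of B.
  IsImplying : Piece F₃ → Poly (EdgeOf B) → Set
  IsImplying q f = ∀ {p S o} → Ωb p → Implicit p q →
    (S , o) ∈ tiles (t̃ p) → pieceAt (t̃ p) (S , o) ≡ q →
    eval f (value (t̄ p) ∘ edge) ≡ 0F ×
    (∀ (z : EdgeOf B → F₃) →
      (∀ e → edge e ∈ map (shift o) (boundary S) → z e ≡ value (t̄ p) (edge e)) →
      ¬ (∀ e → z e ≡ value (t̄ p) (edge e)) →
      eval f z ≡ 1F)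

  record Choice : Set where
    field
      distinguishing   : Orient → Poly (Fin 3)
      forbidding       : Dir → Poly (Fin 4)
      implying         : Piece F₃ → Poly (EdgeOf B)
      isDistinguishing : ∀ τ → IsDistinguishing τ (distinguishing τ)
      isForbidding     : ∀ d → IsForbidding d (forbidding d)
      isImplying       : ∀ {q} → Ω̄i q → IsImplying q (implying q)

open Refinement public using (IsSeparable; Choice)

------------------------------------------------------------------------
-- Puzzle ideals

module _ {n : ℕ} where

  private
    X : Set
    X = EdgeOf (bigTriangle n)

    x : X → Poly X
    x = var

  data 𝓕₁ : Pred (Poly X) 0ℓ where
    cubic : ∀ e → 𝓕₁ (x e ⊗ x e ⊗ x e ⊖ x e)

  data 𝓕̃₁ : Pred (Poly X) 0ℓ where
    cubic     : ∀ e → (∀ j → e ≢ bottomEdge j) → 𝓕̃₁ (x e ⊗ x e ⊗ x e ⊖ x e)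
    quadratic : ∀ j → 𝓕̃₁ (x (bottomEdge j) ⊗ x (bottomEdge j) ⊖ x (bottomEdge j))

  data 𝓕̃₂ (lam mu : Vec F₂ n) : Pred (Poly X) 0ℓ where
    left-side  : ∀ j → 𝓕̃₂ lam mu (x (leftEdge j) ⊖ con (ι₂₃ (lookup lam j)))
    right-side : ∀ j → 𝓕̃₂ lam mu (x (rightEdge j) ⊖ con (ι₂₃ (lookup mu j)))

  data 𝓕₂ (lam mu nu : Vec F₂ n) : Pred (Poly X) 0ℓ where
    left-side   : ∀ j → 𝓕₂ lam mu nu (x (leftEdge j) ⊖ con (ι₂₃ (lookup lam j)))
    right-side  : ∀ j → 𝓕₂ lam mu nu (x (rightEdge j) ⊖ con (ι₂₃ (lookup mu j)))
    bottom-side : ∀ j → 𝓕₂ lam mu nu (x (bottomEdge j) ⊖ con (ι₂₃ (lookup nu j)))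

  data 𝓕₃ : Pred (Poly X) 0ℓ where
    triangle : ∀ τ o (fits : Fits (unit τ) o (bigTriangle n)) →
      𝓕₃ (rename (shiftEdge o fits ∘ unitSides τ) (var 0F ⊕ var 1F ⊕ var 2F))

  module _ {B Ω t̄} (choice : Choice B Ω t̄) where
    open Refinement B Ω t̄ using (Ω̄i)
    open Choice choice

    data 𝓕₄ : Pred (Poly X) 0ℓ where
      triangle : ∀ τ o (fits : Fits (unit τ) o (bigTriangle n)) →
        𝓕₄ (rename (shiftEdge o fits ∘ unitSides τ) (distinguishing τ))

    data 𝓕₅ : Pred (Poly X) 0ℓ where
      rhomb : ∀ d o (fits : Fits (rhombus d) o (bigTriangle n)) →
        𝓕₅ (rename (shiftEdge o fits ∘ rhombusSides d) (forbidding d))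

    data 𝓕₆ : Pred (Poly X) 0ℓ where
      implicit : ∀ q → Ω̄i q → ∀ o (fits : Fits B o (bigTriangle n)) →
        𝓕₆ (rename (shiftEdge o fits) (implying q))

    puzzleIdeal : (lam mu nu : Vec F₂ n) → Pred (Poly X) 0ℓ
    puzzleIdeal lam mu nu = ⟨ 𝓕₁ ∪ 𝓕₂ lam mu nu ∪ 𝓕₃ ∪ 𝓕₄ ∪ 𝓕₅ ∪ 𝓕₆ ⟩

    freePuzzleIdeal : (lam mu : Vec F₂ n) → Pred (Poly X) 0ℓ
    freePuzzleIdeal lam mu = ⟨ 𝓕̃₁ ∪ 𝓕̃₂ lam mu ∪ 𝓕₃ ∪ 𝓕₄ ∪ 𝓕₅ ∪ 𝓕₆ ⟩

-- The elimination ideal and the zero locus live over the variables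
-- x_b1,…,x_bn, which are indexed by Fin n; ι-bottom is the inclusion of
-- F₃[x_b] into F₃[x].

ι-bottom : ∀ {n} → Poly (Fin n) → Poly (EdgeOf (bigTriangle n))
ι-bottom = rename bottomEdge

elimination : ∀ {n} → Pred (Poly (EdgeOf (bigTriangle n))) 0ℓ → Pred (Poly (Fin n)) 0ℓ
elimination I f = I (ι-bottom f)

V : ∀ {n} → Pred (Poly (Fin n)) 0ℓ → Pred (Vec F₃ n) 0ℓ
V I a = ∀ {f} → I f → eval f (lookup a) ≡ 0F

data PointGenerators {n} (a : Vec F₃ n) : Pred (Poly (Fin n)) 0ℓ where
  linear : ∀ j → PointGenerators a (var j ⊖ con (lookup a j))

pointIdeal : ∀ {n} → Vec F₃ n → Pred (Poly (Fin n)) 0ℓ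
pointIdeal a = ⟨ PointGenerators a ⟩

-- The ideal of F₃[x] generated by I and an ideal of F₃[x_b].
infixl 6 _+ᵇ_

data Image {n} (p : Pred (Poly (Fin n)) 0ℓ) : Pred (Poly (EdgeOf (bigTriangle n))) 0ℓ where
  image : ∀ {f} → p f → Image p (ι-bottom f)

_+ᵇ_ : ∀ {n} → Pred (Poly (EdgeOf (bigTriangle n))) 0ℓ → Pred (Poly (Fin n)) 0ℓ →
       Pred (Poly (EdgeOf (bigTriangle n))) 0ℓ
I +ᵇ p = ⟨ I ∪ Image p ⟩

{-# OPTIONS --safe #-}

-- The ideal I contains x³ − x for every variable x, so over F₃ it consists of
-- all polynomials that vanish on its zero locus.  That locus is finite and
-- decidable, hence the elimination ideal J is the vanishing ideal of an
-- explicit finite set of points, the restrictions of the zeros of I to the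
-- bottom side; they are binary because of the generators x² − x.  So J is
-- radical, and the ideals of these points are its prime components.  In (3),
-- both x² − x and x³ − x are multiples of x − ν when ν is binary.
module Submission where

open import Level using (0ℓ)
open import Data.Nat using (ℕ; _<_; _≤_)
open import Data.Fin using (Fin; _≟_)
open import Data.Fin.Patterns using (1F)
open import Data.List using (List)
open import Data.Vec using (Vec; count; map)
open import Data.Product using (∃; _×_; _,_)
open import Relation.Unary using (Pred; _≐_)
open import Relation.Binary.PropositionalEquality using (_≡_)
open import Defs

open import Algebra.Bundles using (CommutativeRing; RawRing)
import Algebra.Properties.Semiring.Exp as Exp
import Algebra.Solver.Ring as RingSolver
open import Algebra.Solver.Ring.AlmostCommutativeRing
  using (_-Raw-AlmostCommutative⟶_; fromCommutativeRing)
open import Data.Fin.Base using (zero; suc)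
open import Data.Fin.Patterns using (0F; 2F)
import Data.Fin.Properties as Fin
open import Data.List.Base as List using ([]; _∷_; upTo; cartesianProduct; filter)
import Data.List.Membership.DecPropositional as DecMembership
open import Data.List.Membership.Propositional using (_∈_; _∉_; mapWith∈; find; lose)
open import Data.List.Membership.Propositional.Properties
open import Data.List.Relation.Unary.All as All using ()
open import Data.List.Relation.Unary.Any as Any using (Any; here; there; any?)
open import Data.List.Relation.Unary.Any.Properties using (mapWith∈⁺; lookup-index)
open import Data.List.Relation.Unary.AllPairs using ([]; _∷_)
open import Data.List.Relation.Unary.Unique.Propositional using (Unique)
import Data.List.Relation.Unary.Unique.Propositional.Properties as Unique
open import Data.Maybe.Base using (Maybe; just; nothing)
open import Data.Nat.Base using (zero; suc; s≤s)
import Data.Nat.Properties as ℕ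
open import Data.Product.Base using (proj₁; proj₂)
open import Data.Sum.Base using (_⊎_; inj₁; inj₂; [_,_]′)
open import Data.Vec.Base as Vec using (lookup; []; _∷_)
import Data.Vec.Properties as Vec
import Data.Vec.Relation.Unary.All as VecAll
open import Function.Base using (_∘_; id; const; case_of_)
open import Relation.Binary.Definitions using (DecidableEquality)
open import Relation.Binary.PropositionalEquality
  using (_≢_; _≗_; refl; sym; trans; cong; cong₂; subst; module ≡-Reasoning)
open import Relation.Nullary using (¬_; Dec; yes; no; contradiction)
open import Relation.Nullary.Decidable
  using (from-yes; map′; ¬?; decidable-stable; recompute; _×-dec_; _⊎-dec_; _→-dec_)
open import Relation.Unary using (Decidable; _⊆_; _∪_)

open IsIdeal

-- Arithmetic of F₃

+₃-assoc : ∀ a b c → (a +₃ b) +₃ c ≡ a +₃ (b +₃ c)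
+₃-assoc = from-yes (Fin.all? λ a → Fin.all? λ b → Fin.all? λ c → (a +₃ b) +₃ c Fin.≟ a +₃ (b +₃ c))

+₃-comm : ∀ a b → a +₃ b ≡ b +₃ a
+₃-comm = from-yes (Fin.all? λ a → Fin.all? λ b → a +₃ b Fin.≟ b +₃ a)

+₃-identityˡ : ∀ a → 0F +₃ a ≡ a
+₃-identityˡ = from-yes (Fin.all? λ a → 0F +₃ a Fin.≟ a)

+₃-inverseˡ : ∀ a → (-₃ a) +₃ a ≡ 0F
+₃-inverseˡ = from-yes (Fin.all? λ a → (-₃ a) +₃ a Fin.≟ 0F)

*₃-assoc : ∀ a b c → (a *₃ b) *₃ c ≡ a *₃ (b *₃ c)
*₃-assoc = from-yes (Fin.all? λ a → Fin.all? λ b → Fin.all? λ c → (a *₃ b) *₃ c Fin.≟ a *₃ (b *₃ c))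

*₃-comm : ∀ a b → a *₃ b ≡ b *₃ a
*₃-comm = from-yes (Fin.all? λ a → Fin.all? λ b → a *₃ b Fin.≟ b *₃ a)

*₃-identityˡ : ∀ a → 1F *₃ a ≡ a
*₃-identityˡ = from-yes (Fin.all? λ a → 1F *₃ a Fin.≟ a)

*₃-zeroʳ : ∀ a → a *₃ 0F ≡ 0F
*₃-zeroʳ = from-yes (Fin.all? λ a → a *₃ 0F Fin.≟ 0F)

*₃-distribˡ : ∀ a b c → a *₃ (b +₃ c) ≡ a *₃ b +₃ a *₃ c
*₃-distribˡ = from-yes (Fin.all? λ a → Fin.all? λ b → Fin.all? λ c →
  a *₃ (b +₃ c) Fin.≟ a *₃ b +₃ a *₃ c)

*₃-integral : ∀ a b → a *₃ b ≡ 0F → a ≡ 0F ⊎ b ≡ 0F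
*₃-integral = from-yes (Fin.all? λ a → Fin.all? λ b →
  (a *₃ b Fin.≟ 0F) →-dec (a Fin.≟ 0F ⊎-dec b Fin.≟ 0F))

*₃-selfInverse : ∀ a → a ≢ 0F → a *₃ a ≡ 1F
*₃-selfInverse = from-yes (Fin.all? λ a → ¬? (a Fin.≟ 0F) →-dec (a *₃ a Fin.≟ 1F))

-₃≡0⇒≡ : ∀ a b → a +₃ (-₃ b) ≡ 0F → a ≡ b
-₃≡0⇒≡ = from-yes (Fin.all? λ a → Fin.all? λ b → (a +₃ (-₃ b) Fin.≟ 0F) →-dec (a Fin.≟ b))

-₃-inverseʳ : ∀ a → a +₃ (-₃ a) ≡ 0F
-₃-inverseʳ = from-yes (Fin.all? λ a → a +₃ (-₃ a) Fin.≟ 0F)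

cubic-vanishes : ∀ a → a *₃ a *₃ a +₃ (-₃ a) ≡ 0F
cubic-vanishes = from-yes (Fin.all? λ a → a *₃ a *₃ a +₃ (-₃ a) Fin.≟ 0F)

quadratic⇒binary : ∀ a → a *₃ a +₃ (-₃ a) ≡ 0F → ∃ λ b → a ≡ ι₂₃ b
quadratic⇒binary = from-yes (Fin.all? λ a →
  (a *₃ a +₃ (-₃ a) Fin.≟ 0F) →-dec Fin.any? (λ b → a Fin.≟ ι₂₃ b))

-- Polynomials and their ideals

module _ {X : Set} where

  private
    module R = CommutativeRing F₃[ X ]

  -- `con` preserves sums by `con-⊕`, and additive inverses are unique; this completes the
  -- homomorphism needed by the ring solver.
  con-neg : ∀ a → con {X} (-₃ a) ≈ neg (con a)
  con-neg a = ≈-trans (≈-sym (R.+-identityʳ _))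
    (≈-trans (⊕-cong ≈-refl (≈-sym (R.-‿inverseʳ (con a))))
    (≈-trans (≈-sym (⊕-assoc _ _ _))
    (≈-trans (⊕-cong (≈-trans (≈-sym (con-⊕ (-₃ a) a)) (R.reflexive (cong con (+₃-inverseˡ a)))) ≈-refl)
    (⊕-identityˡ _))))

  private
    coefficients : RawRing 0ℓ 0ℓ
    coefficients = record
      { Carrier = F₃ ; _≈_ = _≡_ ; _+_ = _+₃_ ; _*_ = _*₃_ ; -_ = -₃_ ; 0# = 0F ; 1# = 1F }

    con-morphism : coefficients -Raw-AlmostCommutative⟶ fromCommutativeRing F₃[ X ]
    con-morphism = record
      { ⟦_⟧ = con ; +-homo = con-⊕ ; *-homo = con-⊗ ; -‿homo = con-neg
      ; 0-homo = ≈-refl ; 1-homo = ≈-refl }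

    con≟ : ∀ a b → Maybe (con {X} a ≈ con b)
    con≟ a b with a Fin.≟ b
    ... | yes a≡b = just (R.reflexive (cong con a≡b))
    ... | no  _   = nothing

  -- With coefficients in F₃ and a test for their equality, the solver also proves identities that
  -- depend on 3 = 0.
  module Solver = RingSolver coefficients (fromCommutativeRing F₃[ X ]) con-morphism con≟

  open Solver using (solve; _:=_; _:+_; _:*_; _:-_; :-_) renaming (con to :con)

  eval-resp : ∀ {f g : Poly X} → f ≈ g → ∀ a → eval f a ≡ eval g a
  eval-resp ≈-refl a = refl
  eval-resp (≈-sym p) a = sym (eval-resp p a)
  eval-resp (≈-trans p q) a = trans (eval-resp p a) (eval-resp q a)
  eval-resp (⊕-cong p q) a = cong₂ _+₃_ (eval-resp p a) (eval-resp q a)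
  eval-resp (⊗-cong p q) a = cong₂ _*₃_ (eval-resp p a) (eval-resp q a)
  eval-resp (neg-cong p) a = cong -₃_ (eval-resp p a)
  eval-resp (⊕-assoc f g h) a = +₃-assoc (eval f a) _ _
  eval-resp (⊕-comm f g) a = +₃-comm (eval f a) _
  eval-resp (⊕-identityˡ f) a = +₃-identityˡ _
  eval-resp (⊕-inverseˡ f) a = +₃-inverseˡ (eval f a)
  eval-resp (⊗-assoc f g h) a = *₃-assoc (eval f a) _ _
  eval-resp (⊗-comm f g) a = *₃-comm (eval f a) _
  eval-resp (⊗-identityˡ f) a = *₃-identityˡ _
  eval-resp (⊗-distribˡ f g h) a = *₃-distribˡ (eval f a) _ _
  eval-resp (con-⊕ a b) _ = refl
  eval-resp (con-⊗ a b) _ = refl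

  eval-cong : ∀ (f : Poly X) {a b} → a ≗ b → eval f a ≡ eval f b
  eval-cong (con c) a≗b = refl
  eval-cong (var e) a≗b = a≗b e
  eval-cong (f ⊕ g) a≗b = cong₂ _+₃_ (eval-cong f a≗b) (eval-cong g a≗b)
  eval-cong (f ⊗ g) a≗b = cong₂ _*₃_ (eval-cong f a≗b) (eval-cong g a≗b)
  eval-cong (neg f) a≗b = cong -₃_ (eval-cong f a≗b)

  eval-rename : ∀ {Y : Set} (ρ : Y → X) f a → eval (rename ρ f) a ≡ eval f (a ∘ ρ)
  eval-rename ρ (con c) a = refl
  eval-rename ρ (var e) a = refl
  eval-rename ρ (f ⊕ g) a = cong₂ _+₃_ (eval-rename ρ f a) (eval-rename ρ g a)
  eval-rename ρ (f ⊗ g) a = cong₂ _*₃_ (eval-rename ρ f a) (eval-rename ρ g a)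
  eval-rename ρ (neg f) a = cong -₃_ (eval-rename ρ f a)

  Vanishing : (X → F₃) → Pred (Poly X) 0ℓ
  Vanishing a f = eval f a ≡ 0F

  vanishing-isIdeal : ∀ a → IsIdeal F₃[ X ] (Vanishing a)
  vanishing-isIdeal a = record
    { resp     = λ f≈g fa≡0 → trans (sym (eval-resp f≈g a)) fa≡0
    ; zero-mem = refl
    ; +-mem    = λ fa≡0 ga≡0 → cong₂ _+₃_ fa≡0 ga≡0
    ; *-mem    = λ h fa≡0 → trans (cong (eval h a *₃_) fa≡0) (*₃-zeroʳ (eval h a)) }

  ⟨⟩-isIdeal : ∀ S → IsIdeal F₃[ X ] ⟨ S ⟩
  ⟨⟩-isIdeal S = record
    { resp = Ideals.resp ; zero-mem = Ideals.zero-mem ; +-mem = Ideals.+-mem ; *-mem = Ideals.*-mem }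

  ⟨⟩-least : ∀ {S I} → IsIdeal F₃[ X ] I → S ⊆ I → ⟨ S ⟩ ⊆ I
  ⟨⟩-least I S⊆I (Ideals.gen s)      = S⊆I s
  ⟨⟩-least I S⊆I (Ideals.resp p f)   = resp I p (⟨⟩-least I S⊆I f)
  ⟨⟩-least I S⊆I Ideals.zero-mem     = zero-mem I
  ⟨⟩-least I S⊆I (Ideals.+-mem f g)  = +-mem I (⟨⟩-least I S⊆I f) (⟨⟩-least I S⊆I g)
  ⟨⟩-least I S⊆I (Ideals.*-mem h f)  = *-mem I h (⟨⟩-least I S⊆I f)

  -- Reduction of polynomials to constants modulo an ideal.

  Specialises : Pred (Poly X) 0ℓ → (X → F₃) → Pred X 0ℓ
  Specialises T a e = T (var e ⊖ con (a e))

  module _ {T} (I : IsIdeal F₃[ X ] T) where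

    cancel-⊖ : ∀ {f g} → T (f ⊖ g) → T g → T f
    cancel-⊖ {f} {g} f-g g∈T =
      resp I (solve 2 (λ f g → (f :- g) :+ g := f) ≈-refl f g) (+-mem I f-g g∈T)

    neg-mem : ∀ {f} → T f → T (neg f)
    neg-mem {f} f∈T = resp I (solve 1 (λ f → :con 2F :* f := :- f) ≈-refl f) (*-mem I (con 2F) f∈T)

    flip-⊖ : ∀ {f g} → T (f ⊖ g) → T (g ⊖ f)
    flip-⊖ {f} {g} f-g =
      resp I (solve 2 (λ f g → :- (f :- g) := g :- f) ≈-refl f g) (neg-mem f-g)

    -- A non-zero `c` in F₃ is its own inverse, so `f` equals `(f ⊗ con c) ⊗ con c`.
    unit-mem : ∀ {c} → c ≢ 0F → T (con c) → ∀ f → T f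
    unit-mem {c} c≢0 c∈T f = resp I
      (≈-trans (⊗-assoc f (con c) (con c))
        (≈-trans (⊗-cong (≈-refl {f = f})
                   (≈-trans (≈-sym (con-⊗ c c)) (R.reflexive (cong con (*₃-selfInverse c c≢0)))))
          (R.*-identityʳ f)))
      (*-mem I (f ⊗ con c) c∈T)

    -- Congruence modulo an ideal is compatible with the ring operations, so congruences for the
    -- variables pass to every polynomial by induction.
    eval-mod : ∀ {a} → (∀ e → Specialises T a e) → ∀ f → T (f ⊖ con (eval f a))
    eval-mod s (con c) = resp I (≈-sym (R.-‿inverseʳ (con c))) (zero-mem I)
    eval-mod s (var e) = s e
    eval-mod {a} s (f ⊕ g) = resp I
      (≈-trans
        (solve 4 (λ f g c d → (f :- c) :+ (g :- d) := (f :+ g) :- (c :+ d)) ≈-refl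
          f g (con (eval f a)) (con (eval g a)))
        (⊕-cong ≈-refl (neg-cong (≈-sym (con-⊕ (eval f a) (eval g a))))))
      (+-mem I (eval-mod s f) (eval-mod s g))
    eval-mod {a} s (f ⊗ g) = resp I
      (≈-trans
        -- The usual telescoping of a difference of products: fg - cd = g(f - c) + c(g - d).
        (solve 4 (λ f g c d → g :* (f :- c) :+ c :* (g :- d) := (f :* g) :- (c :* d)) ≈-refl
          f g (con (eval f a)) (con (eval g a)))
        (⊕-cong ≈-refl (neg-cong (≈-sym (con-⊗ (eval f a) (eval g a))))))
      (+-mem I (*-mem I g (eval-mod s f)) (*-mem I (con (eval f a)) (eval-mod s g)))
    eval-mod {a} s (neg f) = resp I
      (≈-trans
        (solve 2 (λ f c → :- (f :- c) := :- f :- :- c) ≈-refl f (con (eval f a)))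
        (⊕-cong ≈-refl (neg-cong (≈-sym (con-neg (eval f a))))))
      (neg-mem (eval-mod s f))

    -- This is the ideal quotient (T : d). Taking for `d` the indicator of a value of a variable
    -- will fix that variable.
    colon-isIdeal : ∀ d → IsIdeal F₃[ X ] (λ f → T (f ⊗ d))
    colon-isIdeal d = record
      { resp     = λ f≈g → resp I (⊗-cong f≈g ≈-refl)
      ; zero-mem = resp I (≈-sym (R.zeroˡ d)) (zero-mem I)
      ; +-mem    = λ {f} {g} fd gd → resp I (≈-sym (R.distribʳ d f g)) (+-mem I fd gd)
      ; *-mem    = λ h {f} fd → resp I (≈-sym (⊗-assoc h f d)) (*-mem I h fd) }

    colon-⊆ : ∀ d {f} → T f → T (f ⊗ d)
    colon-⊆ d {f} f∈T = resp I (⊗-comm d f) (*-mem I d f∈T)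

  -- Lagrange polynomials, a Nullstellensatz over F₃ and finite search.

  lagrange : X → F₃ → Poly X
  -- The interpolation polynomial in `var e` with value 1 at the given constant and 0 at the other
  -- two elements of F₃.
  lagrange e 0F = con 1F ⊖ var e ⊗ var e
  lagrange e 1F = neg (var e ⊗ var e) ⊖ var e
  lagrange e 2F = neg (var e ⊗ var e) ⊕ var e

  -- A partition of unity: the three Lagrange polynomials add up to 1 - 3x², and 3 = 0.
  lagrange-sum : ∀ e h →
    h ⊗ lagrange e 0F ⊕ h ⊗ lagrange e 1F ⊕ h ⊗ lagrange e 2F ≈ h
  lagrange-sum e h = solve 2 (λ x h →
    h :* (:con 1F :- x :* x) :+ h :* (:- (x :* x) :- x) :+ h :* (:- (x :* x) :+ x) := h)
    ≈-refl (var e) h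

  -- The product of x - d over d ≠ c takes the value -1 at c, so the Lagrange polynomial is minus
  -- this product; hence the factor 2 = -1.
  lagrange-cubic : ∀ e c →
    con 2F ⊗ (var e ⊗ var e ⊗ var e ⊖ var e) ≈ (var e ⊖ con c) ⊗ lagrange e c
  lagrange-cubic e 0F = solve 1 (λ x →
    :con 2F :* (x :* x :* x :- x) := (x :- :con 0F) :* (:con 1F :- x :* x)) ≈-refl (var e)
  lagrange-cubic e 1F = solve 1 (λ x →
    :con 2F :* (x :* x :* x :- x) := (x :- :con 1F) :* (:- (x :* x) :- x)) ≈-refl (var e)
  lagrange-cubic e 2F = solve 1 (λ x →
    :con 2F :* (x :* x :* x :- x) := (x :- :con 2F) :* (:- (x :* x) :+ x)) ≈-refl (var e)

  ContainsCubics : Pred (Poly X) 0ℓ → Set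
  ContainsCubics T = ∀ e → T (var e ⊗ var e ⊗ var e ⊖ var e)

  module _ (_≟ˣ_ : DecidableEquality X) where

    _[_↦_] : (X → F₃) → X → F₃ → X → F₃
    (a [ e ↦ c ]) e′ with e′ ≟ˣ e
    ... | yes _ = c
    ... | no  _ = a e′

    [↦]-self : ∀ a e → a [ e ↦ a e ] ≗ a
    [↦]-self a e e′ with e′ ≟ˣ e
    ... | yes refl = refl
    ... | no  _    = refl

    [↦]-cong : ∀ {a b} es e c → (∀ {e′} → e′ ∈ es → a e′ ≡ b e′) →
      ∀ {e′} → e′ ∈ e ∷ es → (a [ e ↦ c ]) e′ ≡ (b [ e ↦ c ]) e′
    [↦]-cong es e c a≡b {e′} e′∈ with e′ ≟ˣ e
    ... | yes _ = refl
    [↦]-cong es e c a≡b (here e′≡e)  | no e′≢e = contradiction e′≡e e′≢e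
    [↦]-cong es e c a≡b (there e′∈)  | no _    = a≡b e′∈

    -- For `e` itself, x - c times its Lagrange polynomial is a multiple of the cubic. For the other
    -- variables the congruence is inherited, as an ideal lies in its quotients.
    lagrange-specialises : ∀ {T} → IsIdeal F₃[ X ] T → ContainsCubics T → ∀ es {a} →
      (∀ {e} → e ∈ es → Specialises T a e) → ∀ e c {e′} → e′ ∈ e ∷ es →
      Specialises (λ f → T (f ⊗ lagrange e c)) (a [ e ↦ c ]) e′
    lagrange-specialises I cubics es s e c {e′} e′∈ with e′ ≟ˣ e
    ... | yes refl = resp I (lagrange-cubic e c) (*-mem I (con 2F) (cubics e))
    lagrange-specialises I cubics es s e c (here e′≡e) | no e′≢e = contradiction e′≡e e′≢e
    lagrange-specialises I cubics es s e c (there e′∈) | no _    = colon-⊆ I (lagrange e c) (s e′∈)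

    -- The quotient of F₃[X] by an ideal containing the cubics is the product
    -- of its quotients by the ideals (T : lagrange e c), in which var e ≡ c.
    local⇒global : ∀ es {T} → IsIdeal F₃[ X ] T → ContainsCubics T → ∀ h →
      (∀ {T′} a → IsIdeal F₃[ X ] T′ → T ⊆ T′ → (∀ {e} → e ∈ es → Specialises T′ a e) → T′ h) →
      T h
    local⇒global []       I cubics h local = local (const 0F) I id λ ()
    local⇒global (e ∷ es) I cubics h local =
      -- The variables in `es` are fixed first. The resulting `T′` is then split into its three
      -- quotients for `e`, and the partition of unity recovers `h`.
      local⇒global es I cubics h λ {T′} a I′ T⊆T′ s →
      let h∈colon : ∀ c → T′ (h ⊗ lagrange e c)
          h∈colon c = local (a [ e ↦ c ]) (colon-isIdeal I′ (lagrange e c))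
            (λ f∈T → colon-⊆ I′ (lagrange e c) (T⊆T′ f∈T))
            (lagrange-specialises I′ (λ e → T⊆T′ (cubics e)) es {a} s e c)
      in resp I′ (lagrange-sum e h) (+-mem I′ (+-mem I′ (h∈colon 0F) (h∈colon 1F)) (h∈colon 2F))

    -- With all variables fixed at `a`, every polynomial is congruent to its value there: either `h`
    -- becomes 0, or some `g` in `T` becomes a non-zero constant and `T′` is the unit ideal. The
    -- disjunction is a constructive form of `h` vanishing on the zeros of `T`.
    nullstellensatz : ∀ {es} → (∀ e → e ∈ es) → ∀ {T} → IsIdeal F₃[ X ] T → ContainsCubics T → ∀ h →
      (∀ a → Vanishing a h ⊎ ∃ λ g → T g × ¬ Vanishing a g) → T h
    nullstellensatz {es} complete I cubics h vanishing =
      local⇒global es I cubics h λ {T′} a I′ T⊆T′ s →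
      let mod = eval-mod I′ {a} (λ e → s (complete e)) in
      [ (λ ha≡0 → cancel-⊖ I′ (mod h) (subst (T′ ∘ con) (sym ha≡0) (zero-mem I′)))
      , (λ (g , g∈T , ga≢0) → unit-mem I′ ga≢0 (cancel-⊖ I′ (flip-⊖ I′ (mod g)) (T⊆T′ g∈T)) h)
      ]′ (vanishing a)

    -- By the last argument `A` depends only on the values at the finitely many entries of `es`, so
    -- trying three values at each entry is exhaustive.
    search : ∀ es {A : Pred (X → F₃) 0ℓ} → Decidable A →
      (∀ {a b} → (∀ {e} → e ∈ es → a e ≡ b e) → A a → A b) → Dec (∃ A)
    -- No value matters any more, so one arbitrary assignment decides the question.
    search []       A? ext = map′ (_ ,_) (λ (a , p) → ext (λ ()) p) (A? (const 0F))
    search (e ∷ es) A? ext = map′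
      (λ (a , c , p) → a [ e ↦ c ] , p)
      (λ (a , p) → a , a e , ext (λ {e′} _ → sym ([↦]-self a e e′)) p)
      (search es (λ a → Fin.any? λ c → A? (a [ e ↦ c ]))
        (λ a≡b (c , p) → c , ext ([↦]-cong es e c a≡b) p))

-- Renaming of variables and contraction of ideals.

module _ {X Y : Set} (ρ : X → Y) where

  rename-resp : ∀ {f g} → f ≈ g → rename ρ f ≈ rename ρ g
  rename-resp ≈-refl = ≈-refl
  rename-resp (≈-sym p) = ≈-sym (rename-resp p)
  rename-resp (≈-trans p q) = ≈-trans (rename-resp p) (rename-resp q)
  rename-resp (⊕-cong p q) = ⊕-cong (rename-resp p) (rename-resp q)
  rename-resp (⊗-cong p q) = ⊗-cong (rename-resp p) (rename-resp q)
  rename-resp (neg-cong p) = neg-cong (rename-resp p)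
  rename-resp (⊕-assoc f g h) = ⊕-assoc _ _ _
  rename-resp (⊕-comm f g) = ⊕-comm _ _
  rename-resp (⊕-identityˡ f) = ⊕-identityˡ _
  rename-resp (⊕-inverseˡ f) = ⊕-inverseˡ _
  rename-resp (⊗-assoc f g h) = ⊗-assoc _ _ _
  rename-resp (⊗-comm f g) = ⊗-comm _ _
  rename-resp (⊗-identityˡ f) = ⊗-identityˡ _
  rename-resp (⊗-distribˡ f g h) = ⊗-distribˡ _ _ _
  rename-resp (con-⊕ a b) = con-⊕ a b
  rename-resp (con-⊗ a b) = con-⊗ a b

  -- The preimage of an ideal under a ring homomorphism is an ideal; for `ρ = bottomEdge` it is the
  -- elimination ideal.
  contraction-isIdeal : ∀ {T} → IsIdeal F₃[ Y ] T → IsIdeal F₃[ X ] (T ∘ rename ρ)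
  contraction-isIdeal I = record
    { resp     = λ f≈g → resp I (rename-resp f≈g)
    ; zero-mem = zero-mem I
    ; +-mem    = +-mem I
    ; *-mem    = λ h → *-mem I (rename ρ h) }

-- Point ideals

module _ {n : ℕ} where

  private
    module E = Exp (CommutativeRing.semiring F₃[ Fin n ])

  -- The linear generators vanish at `a`; conversely every `f` is congruent to its value at `a`
  -- modulo them.
  pointIdeal≐Vanishing : ∀ (a : Vec F₃ n) → pointIdeal a ≐ Vanishing (lookup a)
  pointIdeal≐Vanishing a =
    ⟨⟩-least (vanishing-isIdeal (lookup a)) (λ { (linear j) → -₃-inverseʳ (lookup a j) }) ,
    λ {f} fa≡0 → cancel-⊖ I (eval-mod I (λ j → Ideals.gen (linear j)) f)
      (subst (pointIdeal a ∘ con) (sym fa≡0) (zero-mem I))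
    where I = ⟨⟩-isIdeal (PointGenerators a)

  -- The point ideal is the kernel of evaluation at `a`, and F₃ is an integral domain.
  pointIdeal-isPrime : ∀ (a : Vec F₃ n) → IsPrime F₃[ Fin n ] (pointIdeal a)
  pointIdeal-isPrime a = record
    { isIdeal = ⟨⟩-isIdeal (PointGenerators a)
    ; proper  = λ 1∈ → case proj₁ (pointIdeal≐Vanishing a) 1∈ of λ ()
    ; prime   = λ f g fg∈ → case *₃-integral (eval f (lookup a)) (eval g (lookup a))
                                   (proj₁ (pointIdeal≐Vanishing a) fg∈) of λ where
        (inj₁ fa≡0) → inj₁ (proj₂ (pointIdeal≐Vanishing a) fa≡0)
        (inj₂ ga≡0) → inj₂ (proj₂ (pointIdeal≐Vanishing a) ga≡0) }

  pointIdeal-injective : ∀ (a b : Vec F₃ n) → pointIdeal a ⊆ pointIdeal b → a ≡ b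
  pointIdeal-injective a b a⊆b = begin
    a                        ≡⟨ Vec.tabulate∘lookup a ⟨
    Vec.tabulate (lookup a)  ≡⟨ Vec.tabulate-cong (λ j → sym (-₃≡0⇒≡ (lookup b j) (lookup a j)
                                  (proj₁ (pointIdeal≐Vanishing b) (a⊆b (Ideals.gen (linear j)))))) ⟩
    Vec.tabulate (lookup b)  ≡⟨ Vec.tabulate∘lookup b ⟩
    b                        ∎
    where open ≡-Reasoning

  -- Point ideals are maximal: a member of `K` not vanishing at `a` would put a non-zero constant
  -- into `K`.
  proper⊇pointIdeal : ∀ (a : Vec F₃ n) {K} → IsIdeal F₃[ Fin n ] K → ¬ K (con 1F) →
    pointIdeal a ⊆ K → K ≐ pointIdeal a
  proper⊇pointIdeal a {K} I proper a⊆K =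
    (λ {f} f∈K → proj₂ (pointIdeal≐Vanishing a) (decidable-stable (eval f (lookup a) Fin.≟ 0F)
      λ fa≢0 → proper (unit-mem I fa≢0
        (cancel-⊖ I (flip-⊖ I (eval-mod I (λ j → a⊆K (Ideals.gen (linear j))) f)) f∈K) (con 1F)))) ,
    a⊆K

  vanishing-radical : ∀ a f m → Vanishing a (f E.^ m) → Vanishing a f
  -- Exponent 0 is excluded by the hypothesis, since the constant 1 does not vanish.
  vanishing-radical a f (suc m) f^m≡0 with *₃-integral (eval f a) _ f^m≡0
  ... | inj₁ fa≡0   = fa≡0
  ... | inj₂ f^m≡0′ = vanishing-radical a f m f^m≡0′

-- Quadratic relations and binary values.

module _ {X : Set} {T} (I : IsIdeal F₃[ X ] T) where

  open Solver {X} using (solve; _:=_; _:+_; _:*_; _:-_) renaming (con to :con)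

  quadratic⇒cubic : ∀ {e} → T (var e ⊗ var e ⊖ var e) → T (var e ⊗ var e ⊗ var e ⊖ var e)
  quadratic⇒cubic {e} q = resp I
    (solve 1 (λ x → (x :+ :con 1F) :* (x :* x :- x) := x :* x :* x :- x) ≈-refl (var e))
    (*-mem I (var e ⊕ con 1F) q)

  binary⇒quadratic : ∀ {e} b → T (var e ⊖ con (ι₂₃ b)) → T (var e ⊗ var e ⊖ var e)
  binary⇒quadratic {e} 0F x-b = resp I
    (solve 1 (λ x → (x :- :con 1F) :* (x :- :con 0F) := x :* x :- x) ≈-refl (var e))
    (*-mem I (var e ⊖ con 1F) x-b)
  binary⇒quadratic {e} 1F x-b = resp I
    (solve 1 (λ x → x :* (x :- :con 1F) := x :* x :- x) ≈-refl (var e))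
    (*-mem I (var e) x-b)

-- A prime ideal containing x(x - 1) contains one of the two factors.
prime⇒binary : ∀ {X T} → IsPrime F₃[ X ] T → ∀ {e} → T (var e ⊗ var e ⊖ var e) →
  ∃ λ b → T (var e ⊖ con (ι₂₃ b))
prime⇒binary {X} P {e} q = case prime (var e ⊖ con 0F) (var e ⊖ con 1F) (resp isIdeal
    (solve 1 (λ x → x :* x :- x := (x :- :con 0F) :* (x :- :con 1F)) ≈-refl (var e)) q) of λ where
    (inj₁ x-0) → 0F , x-0
    (inj₂ x-1) → 1F , x-1
  where
  open Ideals.IsPrime P
  open Solver {X} using (solve; _:=_; _:*_; _:-_) renaming (con to :con)

-- Enumerations

binaryVectors : ∀ n → List (Vec F₂ n)
binaryVectors zero    = [] ∷ []
binaryVectors (suc n) = List.cartesianProductWith _∷_ (List.allFin 2) (binaryVectors n)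

binaryVectors-complete : ∀ {n} (v : Vec F₂ n) → v ∈ binaryVectors n
binaryVectors-complete []      = here refl
binaryVectors-complete (b ∷ v) = ∈-cartesianProductWith⁺ _∷_ (∈-allFin b) (binaryVectors-complete v)

binaryVectors-unique : ∀ n → Unique (binaryVectors n)
binaryVectors-unique zero    = All.[] ∷ []
binaryVectors-unique (suc n) =
  Unique.cartesianProductWith⁺ _∷_ Vec.∷-injective (Unique.allFin⁺ 2) (binaryVectors-unique n)

lookup-injective : ∀ {A : Set} {xs : List A} → Unique xs →
  ∀ i j → List.lookup xs i ≡ List.lookup xs j → i ≡ j
lookup-injective (x∉ ∷ u) zero    zero    eq = refl
lookup-injective (x∉ ∷ u) zero    (suc j) eq = contradiction eq (All.lookup x∉ (∈-lookup j))
lookup-injective (x∉ ∷ u) (suc i) zero    eq = contradiction (sym eq) (All.lookup x∉ (∈-lookup i))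
lookup-injective (x∉ ∷ u) (suc i) (suc j) eq = cong suc (lookup-injective u i j eq)

map-injective : ∀ {A B : Set} {f : A → B} → (∀ {x y} → f x ≡ f y → x ≡ y) →
  ∀ {n} {u v : Vec A n} → map f u ≡ map f v → u ≡ v
map-injective inj {u = []}    {[]}    eq = refl
map-injective inj {u = _ ∷ _} {_ ∷ _} eq =
  cong₂ _∷_ (inj (Vec.∷-injectiveˡ eq)) (map-injective inj (Vec.∷-injectiveʳ eq))

-- Unit intervals of a polygon.

infix 4 _≟ᵉᵒ_

_≟ᵉᵒ_ : ∀ {P} → DecidableEquality (EdgeOf P)
x ≟ᵉᵒ y = map′ edge-injective (cong edge) (edge x ≟ᵉ edge y)
  where
  edge-injective : ∀ {P} {x y : EdgeOf P} → edge x ≡ edge y → x ≡ y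
  -- The proof of lying inside the polygon is an irrelevant field, so it cannot distinguish two
  -- elements.
  edge-injective {x = edgeOf e _} {edgeOf .e _} refl = refl

module _ (P : Hexagon) where

  open Hexagon P

  private
    dirs : List Dir
    dirs = left ∷ right ∷ bottom ∷ []

    grid : List Cell
    grid = cartesianProduct (△ ∷ ▽ ∷ []) (cartesianProduct (upTo height) (upTo width))

    ∈-dirs : ∀ d → d ∈ dirs
    ∈-dirs left   = here refl
    ∈-dirs right  = there (here refl)
    ∈-dirs bottom = there (there (here refl))

    ∈-orients : ∀ τ → τ ∈ △ ∷ ▽ ∷ []
    ∈-orients △ = here refl
    ∈-orients ▽ = there (here refl)

  ∈-cells : ∀ {t} → CellIn P t → t ∈ cells P
  ∈-cells {τ , r , c} t∈P@(r< , c< , _) = ∈-filter⁺ (cellIn? P)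
    (∈-cartesianProduct⁺ (∈-orients τ) (∈-cartesianProduct⁺ (∈-upTo⁺ r<) (∈-upTo⁺ c<))) t∈P

  ∈-cellSides⁺ : ∀ {e} → (∃ λ t → CellIn P t × ∃ λ d → side t d ≡ e) → e ∈ cellSides P
  ∈-cellSides⁺ (t , t∈P , d , refl) = ∈-cartesianProductWith⁺ side (∈-cells t∈P) (∈-dirs d)

  ∈-cellSides⁻ : ∀ {e} → e ∈ cellSides P → ∃ λ t → CellIn P t × ∃ λ d → side t d ≡ e
  ∈-cellSides⁻ e∈ =
    let t , d , t∈ , _ , e≡ = ∈-cartesianProductWith⁻ side (cells P) dirs e∈
    in t , proj₂ (∈-filter⁻ (cellIn? P) {xs = grid} t∈) , d , sym e≡

  edges : List (EdgeOf P)
  edges = mapWith∈ (cellSides P) λ {e} e∈ → edgeOf e (∈-cellSides⁻ e∈)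

  edges-complete : ∀ e → e ∈ edges
  edges-complete (edgeOf e inside) = mapWith∈⁺ _
    -- The irrelevant `inside` proves membership only irrelevantly; decidability of membership turns
    -- this into a usable proof.
    (e , recompute (DecMembership._∈?_ _≟ᵉ_ e (cellSides P)) (∈-cellSides⁺ inside) , refl)

-- Decidable search over orientations, directions and translates.

orient-any? : {A : Pred Orient 0ℓ} → Decidable A → Dec (∃ A)
orient-any? A? = map′ [ (△ ,_) , (▽ ,_) ]′ (λ { (△ , a) → inj₁ a ; (▽ , a) → inj₂ a })
  (A? △ ⊎-dec A? ▽)

dir-any? : {A : Pred Dir 0ℓ} → Decidable A → Dec (∃ A)
dir-any? A? = map′ [ (left ,_) , [ (right ,_) , (bottom ,_) ]′ ]′
  (λ { (left , a) → inj₁ a ; (right , a) → inj₂ (inj₁ a) ; (bottom , a) → inj₂ (inj₂ a) })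
  (A? left ⊎-dec A? right ⊎-dec A? bottom)

module _ {P Q : Hexagon} where

  fits? : ∀ o → Dec (Fits P o Q)
  fits? (i , j) = map′
    (λ (h , w , l , u) → record { fit-height = h ; fit-width = w ; fit-lo = l ; fit-hi = u })
    (λ f → let open Fits f in fit-height , fit-width , fit-lo , fit-hi)
    (_ ℕ.≤? _ ×-dec _ ℕ.≤? _ ×-dec _ ℕ.≤? _ ×-dec _ ℕ.≤? _)

  -- A translate that fits has its offset bounded by the height and width of `Q`, so finitely many
  -- offsets are tested. As `A` takes the proof of fitting irrelevantly, one such proof per offset
  -- suffices.
  fits-any? : {A : ∀ o → .(Fits P o Q) → Set} → (∀ o .(fits : Fits P o Q) → Dec (A o fits)) →
    Dec (∃ λ o → ∃ λ (fits : Fits P o Q) → A o fits)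
  fits-any? {A} A? = map′
    (λ any → let o , _ , found = find any in o , found)
    (λ (o , fits , a) → lose
      (∈-cartesianProduct⁺ (∈-upTo⁺ (s≤s (ℕ.m+n≤o⇒m≤o (proj₁ o) (Fits.fit-height fits))))
                           (∈-upTo⁺ (s≤s (ℕ.m+n≤o⇒m≤o (proj₂ o) (Fits.fit-width fits)))))
      (fits , a))
    (any? at? (cartesianProduct (upTo (suc (Hexagon.height Q))) (upTo (suc (Hexagon.width Q)))))
    where
    at? : ∀ o → Dec (∃ λ (fits : Fits P o Q) → A o fits)
    at? o with fits? o
    ... | yes fits = map′ (fits ,_) proj₂ (A? o fits)
    ... | no ¬fits = no (¬fits ∘ proj₁)

-- The zero locus of a free puzzle ideal

module _ {X : Set} where

  vanishing? : ∀ a (f : Poly X) → Dec (Vanishing a f)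
  vanishing? a f = eval f a Fin.≟ 0F

  -- A witnessed form of not being a zero of `S`; deciding it supplies the disjunction that
  -- `nullstellensatz` asks for.
  NonVanishing : Pred (Poly X) 0ℓ → Pred (X → F₃) 0ℓ
  NonVanishing S a = ∃ λ g → S g × ¬ Vanishing a g

  nonVanishing-∪? : ∀ {S T} → Decidable (NonVanishing S) → Decidable (NonVanishing T) →
    Decidable (NonVanishing (S ∪ T))
  nonVanishing-∪? S? T? a = map′
    [ (λ (g , s , ≢0) → g , inj₁ s , ≢0) , (λ (g , t , ≢0) → g , inj₂ t , ≢0) ]′
    (λ { (g , inj₁ s , ≢0) → inj₁ (g , s , ≢0) ; (g , inj₂ t , ≢0) → inj₂ (g , t , ≢0) })
    (S? a ⊎-dec T? a)

  nonVanishing-resp : ∀ {S a b} → a ≗ b → NonVanishing S a → NonVanishing S b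
  nonVanishing-resp a≗b (g , s , ≢0) = g , s , ≢0 ∘ trans (eval-cong g a≗b)

  zero⇒vanishing : ∀ {S a} → ¬ NonVanishing S a → ⟨ S ⟩ ⊆ Vanishing a
  zero⇒vanishing {a = a} ¬nz = ⟨⟩-least (vanishing-isIdeal a) λ {g} s →
    decidable-stable (vanishing? a g) λ ≢0 → ¬nz (g , s , ≢0)

module _ {n : ℕ} where

  -- The cubics vanish at every point over F₃, so only the quadratics have to be tested.
  𝓕̃₁? : Decidable (NonVanishing (𝓕̃₁ {n}))
  𝓕̃₁? a = map′ (λ (j , ≢0) → _ , quadratic j , ≢0)
    (λ { (_ , cubic e _ , ≢0) → contradiction (cubic-vanishes (a e)) ≢0
       ; (_ , quadratic j , ≢0) → j , ≢0 })
    (Fin.any? λ j → ¬? (vanishing? a (var (bottomEdge j) ⊗ var (bottomEdge j) ⊖ var (bottomEdge j))))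

  𝓕̃₂? : ∀ lam mu → Decidable (NonVanishing (𝓕̃₂ {n} lam mu))
  𝓕̃₂? lam mu a = map′
    [ (λ (j , ≢0) → _ , left-side j , ≢0) , (λ (j , ≢0) → _ , right-side j , ≢0) ]′
    (λ { (_ , left-side j , ≢0) → inj₁ (j , ≢0) ; (_ , right-side j , ≢0) → inj₂ (j , ≢0) })
    (Fin.any? (λ j → ¬? (vanishing? a (var (leftEdge j) ⊖ con (ι₂₃ (lookup lam j))))) ⊎-dec
     Fin.any? (λ j → ¬? (vanishing? a (var (rightEdge j) ⊖ con (ι₂₃ (lookup mu j))))))

  𝓕₃? : Decidable (NonVanishing (𝓕₃ {n}))
  𝓕₃? a = map′ (λ (τ , o , fits , ≢0) → _ , triangle τ o fits , ≢0)
    (λ { (_ , triangle τ o fits , ≢0) → τ , o , fits , ≢0 })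
    (orient-any? λ τ → fits-any? λ o fits →
      ¬? (vanishing? a (rename (shiftEdge o fits ∘ unitSides τ) (var 0F ⊕ var 1F ⊕ var 2F))))

  module _ {B Ω t̄} (choice : Choice B Ω t̄) where

    open Refinement B Ω t̄ using (t̃; ImplicitKind)
    open Choice choice

    𝓕₄? : Decidable (NonVanishing (𝓕₄ {n} choice))
    𝓕₄? a = map′ (λ (τ , o , fits , ≢0) → _ , triangle τ o fits , ≢0)
      (λ { (_ , triangle τ o fits , ≢0) → τ , o , fits , ≢0 })
      (orient-any? λ τ → fits-any? λ o fits →
        ¬? (vanishing? a (rename (shiftEdge o fits ∘ unitSides τ) (distinguishing τ))))

    𝓕₅? : Decidable (NonVanishing (𝓕₅ {n} choice))
    𝓕₅? a = map′ (λ (d , o , fits , ≢0) → _ , rhomb d o fits , ≢0)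
      (λ { (_ , rhomb d o fits , ≢0) → d , o , fits , ≢0 })
      (dir-any? λ d → fits-any? λ o fits →
        ¬? (vanishing? a (rename (shiftEdge o fits ∘ rhombusSides d) (forbidding d))))

    implicitKind? : Decidable ImplicitKind
    implicitKind? (P , v) =
      ((P ≟ʰ unit △ ⊎-dec P ≟ʰ unit ▽) ×-dec VecAll.all? (Fin._≟ 2F) v) ⊎-dec
      (dir-any? (λ d → P ≟ʰ rhombus d) ×-dec VecAll.all? (λ b → ¬? (b Fin.≟ 2F)) v)

    -- Every implicit piece occurs in the stitching of some member of the finite list `Ω`, so the
    -- search runs over these lists instead of all pieces.
    𝓕₆? : Decidable (NonVanishing (𝓕₆ {n} choice))
    𝓕₆? a = map′ to from (any? at? Ω)
      where
      open DecMembership _≟ᵖ_ using () renaming (_∈?_ to _∈ᵖ?_)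

      NonVanishingFor : Pred (Piece F₃) 0ℓ
      NonVanishingFor q = ∃ λ o → ∃ λ (fits : Fits B o (bigTriangle n)) →
        ¬ Vanishing a (rename (shiftEdge o fits) (implying q))

      At : Pred (Piece F₂) 0ℓ
      At p = shape p ≡ B ×
        Any (λ q → q ∉ List.map embed Ω × ImplicitKind q × NonVanishingFor q) (pieces (t̃ p))

      at? : Decidable At
      at? p = shape p ≟ʰ B ×-dec
        any? (λ q → ¬? (q ∈ᵖ? List.map embed Ω) ×-dec implicitKind? q ×-dec
          fits-any? (λ o fits → ¬? (vanishing? a (rename (shiftEdge o fits) (implying q)))))
          (pieces (t̃ p))

      to : Any At Ω → NonVanishing (𝓕₆ choice) a
      to any =
        let p , p∈Ω , shape≡B , any′ = find any
            q , q∈ , q∉Ω , kind , o , fits , ≢0 = find any′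
        in _ , implicit q (p , (p∈Ω , shape≡B) , q∈ , q∉Ω , kind) o fits , ≢0

      from : NonVanishing (𝓕₆ choice) a → Any At Ω
      from (_ , implicit q (p , (p∈Ω , shape≡B) , q∈ , q∉Ω , kind) o fits , ≢0) =
        lose p∈Ω (shape≡B , lose q∈ (q∉Ω , kind , o , fits , ≢0))

    -- The elimination ideal, its prime decomposition and the puzzle ideals.

    module _ (lam mu : Vec F₂ n) where

      private
        X : Set
        X = EdgeOf (bigTriangle n)

        Generators : Pred (Poly X) 0ℓ
        Generators = 𝓕̃₁ ∪ 𝓕̃₂ lam mu ∪ 𝓕₃ ∪ 𝓕₄ choice ∪ 𝓕₅ choice ∪ 𝓕₆ choice

        I : Pred (Poly X) 0ℓ
        I = freePuzzleIdeal choice lam mu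

        J : Pred (Poly (Fin n)) 0ℓ
        J = elimination I

        I-isIdeal : IsIdeal F₃[ X ] I
        I-isIdeal = ⟨⟩-isIdeal Generators

        J-isIdeal : IsIdeal F₃[ Fin n ] J
        J-isIdeal = contraction-isIdeal bottomEdge I-isIdeal

        bottom-quadratic : ∀ j → J (var j ⊗ var j ⊖ var j)
        bottom-quadratic j = Ideals.gen (inj₁ (quadratic j))

        cubics : ContainsCubics I
        cubics e with Fin.any? (λ j → e ≟ᵉᵒ bottomEdge j)
        ... | yes (j , refl) = quadratic⇒cubic I-isIdeal (bottom-quadratic j)
        ... | no  ¬bottom    = Ideals.gen (inj₁ (cubic e λ j e≡ → ¬bottom (j , e≡)))

        nonVanishing? : Decidable (NonVanishing Generators)
        nonVanishing? = nonVanishing-∪? 𝓕̃₁? (nonVanishing-∪? (𝓕̃₂? lam mu) (nonVanishing-∪? 𝓕₃?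
          (nonVanishing-∪? 𝓕₄? (nonVanishing-∪? 𝓕₅? 𝓕₆?))))

        vanishing⇒I : ∀ h → (∀ a → ¬ NonVanishing Generators a → Vanishing a h) → I h
        vanishing⇒I h vanishing =
          nullstellensatz _≟ᵉᵒ_ (edges-complete (bigTriangle n)) I-isIdeal cubics h λ a →
            case nonVanishing? a of λ where
              (yes (g , s , ≢0)) → inj₂ (g , Ideals.gen s , ≢0)
              (no ¬nz)           → inj₁ (vanishing a ¬nz)

        Extends : Vec F₂ n → Pred (X → F₃) 0ℓ
        Extends nu a = ¬ NonVanishing Generators a × (∀ j → lookup (map ι₂₃ nu) j ≡ a (bottomEdge j))

        extendable? : ∀ nu → Dec (∃ (Extends nu))
        extendable? nu = search _≟ᵉᵒ_ (edges (bigTriangle n))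
          (λ a → ¬? (nonVanishing? a) ×-dec Fin.all? λ j → lookup (map ι₂₃ nu) j Fin.≟ a (bottomEdge j))
          (λ a≡b (¬nz , eq) →
            ¬nz ∘ nonVanishing-resp (λ e → sym (a≡b (edges-complete _ e))) ,
            λ j → trans (eq j) (a≡b (edges-complete _ (bottomEdge j))))

      -- The next two lemmas show that `J` is the vanishing ideal of these points.
      bottoms : List (Vec F₂ n)
      bottoms = filter extendable? (binaryVectors n)

      J⇒vanishing : ∀ {f} → J f → ∀ {nu} → nu ∈ bottoms → Vanishing (lookup (map ι₂₃ nu)) f
      J⇒vanishing {f} f∈J {nu} nu∈ =
        let a , ¬nz , eq = proj₂ (∈-filter⁻ extendable? {xs = binaryVectors n} nu∈) in
        begin
          eval f (lookup (map ι₂₃ nu))  ≡⟨ eval-cong f eq ⟩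
          eval f (a ∘ bottomEdge)       ≡⟨ eval-rename bottomEdge f a ⟨
          eval (ι-bottom f) a           ≡⟨ zero⇒vanishing ¬nz f∈J ⟩
          0F                            ∎
        where open ≡-Reasoning

      -- The quadratics make every zero of `I` binary on the bottom side, so its restriction is
      -- listed in `bottoms`.
      vanishing⇒J : ∀ f → (∀ {nu} → nu ∈ bottoms → Vanishing (lookup (map ι₂₃ nu)) f) → J f
      vanishing⇒J f vanishing = vanishing⇒I (ι-bottom f) λ a ¬nz →
        let
          binary = λ j → quadratic⇒binary (a (bottomEdge j)) (zero⇒vanishing ¬nz (bottom-quadratic j))
          nu = Vec.tabulate (proj₁ ∘ binary)
          eq = λ j → trans (Vec.lookup-map j ι₂₃ nu)
                 (trans (cong ι₂₃ (Vec.lookup∘tabulate (proj₁ ∘ binary) j)) (sym (proj₂ (binary j))))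
        in begin
          eval (ι-bottom f) a           ≡⟨ eval-rename bottomEdge f a ⟩
          eval f (a ∘ bottomEdge)       ≡⟨ eval-cong f eq ⟨
          eval f (lookup (map ι₂₃ nu))  ≡⟨ vanishing (∈-filter⁺ extendable?
                                             (binaryVectors-complete nu) (a , ¬nz , eq)) ⟩
          0F                            ∎
        where open ≡-Reasoning

      elimination-isRadical : IsRadical F₃[ Fin n ] J
      elimination-isRadical = record
        { isIdeal = J-isIdeal
        ; radical = λ f m f^m∈J → vanishing⇒J f λ nu∈ →
            vanishing-radical _ f m (J⇒vanishing f^m∈J nu∈) }

      primeDecomposition : IsPrimeDecomposition F₃[ Fin n ] J
        (λ i → pointIdeal (map ι₂₃ (List.lookup bottoms i)))
      primeDecomposition = record
        { isPrime      = λ i → pointIdeal-isPrime _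
        ; intersection =
            (λ f∈J i → proj₂ (pointIdeal≐Vanishing _) (J⇒vanishing f∈J (∈-lookup i))) ,
            (λ {f} f∈ → vanishing⇒J f λ {nu} nu∈ →
              subst (λ nu → Vanishing (lookup (map ι₂₃ nu)) f) (sym (lookup-index nu∈))
                (proj₁ (pointIdeal≐Vanishing _) (f∈ (Any.index nu∈))))
        -- An inclusion of point ideals forces the points to be equal, and `bottoms` has no
        -- repetitions.
        ; irredundant  = λ i j i⊆j →
            lookup-injective (Unique.filter⁺ extendable? (binaryVectors-unique n)) i j
              (map-injective Fin.inject₁-injective (pointIdeal-injective _ _ i⊆j)) }

      -- Each component contains the bottom quadratics; being prime, it contains a binary point
      -- ideal, which it equals by maximality.
      prime-components : ∀ {s} (𝔭 : Fin s → Pred (Poly (Fin n)) 0ℓ) →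
        IsPrimeDecomposition F₃[ Fin n ] J 𝔭 →
        ∀ i → ∃ λ (nu : Vec F₂ n) → 𝔭 i ≐ pointIdeal (map ι₂₃ nu)
      prime-components 𝔭 D i = nu , proper⊇pointIdeal (map ι₂₃ nu) isIdeal proper
        (⟨⟩-least isIdeal λ { (linear j) → subst (λ c → 𝔭 i (var j ⊖ con c))
          (sym (trans (Vec.lookup-map j ι₂₃ nu) (cong ι₂₃ (Vec.lookup∘tabulate (proj₁ ∘ binary) j))))
          (proj₂ (binary j)) })
        where
        open Ideals.IsPrimeDecomposition D
        open Ideals.IsPrime (isPrime i)
        binary = λ j → prime⇒binary (isPrime i) (proj₁ intersection (bottom-quadratic j) i)
        nu = Vec.tabulate (proj₁ ∘ binary)

      zero-isBinary : ∀ a → V J a → ∃ λ (nu : Vec F₂ n) → a ≡ map ι₂₃ nu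
      zero-isBinary a a∈V = Vec.tabulate (proj₁ ∘ binary) , (begin
        a                                        ≡⟨ Vec.tabulate∘lookup a ⟨
        Vec.tabulate (lookup a)                  ≡⟨ Vec.tabulate-cong (proj₂ ∘ binary) ⟩
        Vec.tabulate (ι₂₃ ∘ proj₁ ∘ binary)      ≡⟨ Vec.tabulate-∘ ι₂₃ (proj₁ ∘ binary) ⟩
        map ι₂₃ (Vec.tabulate (proj₁ ∘ binary))  ∎)
        where
        open ≡-Reasoning
        binary = λ j → quadratic⇒binary (lookup a j) (a∈V (bottom-quadratic j))

      -- The generating sets differ only in the cubics and quadratics and in the bottom conditions,
      -- so only these need an argument.
      puzzleIdeal≐ : ∀ nu → puzzleIdeal choice lam mu nu ≐ I +ᵇ pointIdeal (map ι₂₃ nu)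
      puzzleIdeal≐ nu =
        ⟨⟩-least (⟨⟩-isIdeal _) (λ where
          (inj₁ (cubic e))                → Ideals.gen (inj₁ (cubics e))
          (inj₂ (inj₁ (left-side j)))     → free (inj₂ (inj₁ (left-side j)))
          (inj₂ (inj₁ (right-side j)))    → free (inj₂ (inj₁ (right-side j)))
          (inj₂ (inj₁ (bottom-side j)))   →
            subst (λ c → (I +ᵇ pointIdeal (map ι₂₃ nu)) (var (bottomEdge j) ⊖ con c))
              (Vec.lookup-map j ι₂₃ nu) (Ideals.gen (inj₂ (image (Ideals.gen (linear j)))))
          (inj₂ (inj₂ s))                 → free (inj₂ (inj₂ s))) ,
        ⟨⟩-least K-isIdeal (λ where
          (inj₁ f∈I) → ⟨⟩-least K-isIdeal (λ where
            (inj₁ (cubic e _))            → Ideals.gen (inj₁ (cubic e))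
            (inj₁ (quadratic j))          → binary⇒quadratic K-isIdeal (lookup nu j) (bottom∈K j)
            (inj₂ (inj₁ (left-side j)))   → Ideals.gen (inj₂ (inj₁ (left-side j)))
            (inj₂ (inj₁ (right-side j)))  → Ideals.gen (inj₂ (inj₁ (right-side j)))
            (inj₂ (inj₂ s))               → Ideals.gen (inj₂ (inj₂ s))) f∈I
          -- The contraction of the puzzle ideal to the bottom variables is an ideal, so its
          -- containing the linear generators is enough.
          (inj₂ (image f∈p)) → ⟨⟩-least (contraction-isIdeal bottomEdge K-isIdeal)
            (λ { (linear j) → subst (λ c → puzzleIdeal choice lam mu nu (var (bottomEdge j) ⊖ con c))
              (sym (Vec.lookup-map j ι₂₃ nu)) (bottom∈K j) }) f∈p)
        where
        free : Generators ⊆ I +ᵇ pointIdeal (map ι₂₃ nu)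
        free s = Ideals.gen (inj₁ (Ideals.gen s))

        K-isIdeal : IsIdeal F₃[ X ] (puzzleIdeal choice lam mu nu)
        K-isIdeal = ⟨⟩-isIdeal _

        bottom∈K : ∀ j → puzzleIdeal choice lam mu nu (var (bottomEdge j) ⊖ con (ι₂₃ (lookup nu j)))
        bottom∈K j = Ideals.gen (inj₂ (inj₁ (bottom-side j)))

proposition7p3 :
  ∀ (n k : ℕ) → 0 < k → k ≤ n →
  (lam mu : Vec F₂ n) → count (_≟ 1F) lam ≡ k → count (_≟ 1F) mu ≡ k →
  (B : Hexagon) (Ω : List (Piece F₂)) → IsPuzzle B Ω →
  (t̄ : Piece F₂ → Tiling F₃) → IsRefinement Ω t̄ → IsSeparable B Ω t̄ →
  (choice : Choice B Ω t̄) →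
  let I = freePuzzleIdeal choice lam mu
      J = elimination I
  in
  IsRadical F₃[ Fin n ] J
  ×
  ( ∃ (λ (s : ℕ) → ∃ (λ (𝔭 : Fin s → Pred (Poly (Fin n)) 0ℓ) →
      IsPrimeDecomposition F₃[ Fin n ] J 𝔭))
  × (∀ (s : ℕ) (𝔭 : Fin s → Pred (Poly (Fin n)) 0ℓ) →
      IsPrimeDecomposition F₃[ Fin n ] J 𝔭 →
      ∀ i → ∃ (λ (nu : Vec F₂ n) → 𝔭 i ≐ pointIdeal (map ι₂₃ nu))))
  ×
  (∀ (a : Vec F₃ n) → V J a →
    ∃ (λ (nu : Vec F₂ n) → a ≡ map ι₂₃ nu ×
      puzzleIdeal choice lam mu nu ≐ I +ᵇ pointIdeal a))
proposition7p3 n k _ _ lam mu _ _ B Ω _ t̄ _ _ choice =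
  elimination-isRadical choice lam mu ,
  ( (_ , _ , primeDecomposition choice lam mu)
  , λ s → prime-components choice lam mu {s}) ,
  λ a a∈V → case zero-isBinary choice lam mu a a∈V of λ
    { (nu , refl) → nu , refl , puzzleIdeal≐ choice lam mu nu }
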